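{- Let $L$ be an infinite set and consider the edged cube $\bar Q_L$. A basic sequence is convergent over $f_{\mathrm{solved}}$ if and only if it is universally convergent; consequently the set of basic sequences convergent over $f_{\mathrm{solved}}$, taken modulo $\sim$, is exactly the group $\mathrm{UC}_L=\mathrm{uc}_L/{\sim}$ under the operation induced by concatenation. In particular, let $k=\operatorname{lcm}\{\text{order of }\pi:\pi\in S_{24}\}$; if $f$ is the (legal) terminal configuration obtained by applying a basic sequence of length $\theta$ to $f_{\mathrm{solved}}$, then there is a basic sequence of length at most $\theta\cdot(k-1)$ (ordinal product) which, applied to $f$, has terminal configuration $f_{\mathrm{solved}}$.
   Context: Let $L$ be an infinite set, $-L=\{ -r:r\in L\}$ a disjoint copy of $L$, and $0$ a new element; $L^\dagger=-L\cup\{0\}\cup L$ with $-(-r)=r$, $-0=0$. Adjoin $\pm\infty$ with $-(+\infty)=-\infty$ and set $\bar L^\dagger=L^\dagger\cup\{\pm\infty\}$. Points of $U=(\bar L^\dagger)^3$ have coordinates $x,y,z$. The edged cube $\bar Q_L$ is the set of cells $(p,i)$ with $p\in U$, $i\in\{x,y,z\}$, $p_i\in\{\pm\infty\}$ ($i$ marks the face of the cell). For $i\in\{x,y,z\}$, $\alpha\in\bar L^\dagger$, the quarter-turn twist $T_{i,\alpha}$ is the permutation of cells fixing every cell whose point $p$ has $p_i\ne\alpha$ and acting on the others by the rotation $T_{x,\alpha}(\alpha,y,z)=(\alpha,-z,y)$, $T_{y,\alpha}(x,\alpha,z)=(z,\alpha,-x)$, $T_{z,\alpha}(x,y,\alpha)=(-y,x,\alpha)$,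 the marked coordinate being carried along by the rotation. Basic twists are $T,T^2,T^3$ for quarter-turn twists $T$. A basic sequence is a sequence $\langle\sigma_\eta:\eta<\theta\rangle$ of basic twists of ordinal length $\theta$. A labelling is a map $f$ from cells to $X\cup\{\mathrm{NaC}\}$ for a set $X\not\ni\mathrm{NaC}$; it is legal if it never takes value NaC; a configuration is a labelling with $X$ the six colors red, white, green, orange, yellow, blue. The solved configuration $f_{\mathrm{solved}}$ colors cell $(p,i)$ red, blue, white, orange, green, yellow according as $p_i=+\infty$ with $i=x,y,z$, or $p_i=-\infty$ with $i=x,y,z$, respectively. A twist $\sigma$ acts by $(\sigma f)(c)=f(\sigma^{ -1}c)$. Applying $\langle\sigma_\eta:\eta<\theta\rangle$ to $f_0$ produces $f_{\eta+1}=\sigma_\eta f_\eta$, and for limit $\lambda\le\theta$, $f_\lambda(c)$ is the eventually constant value of $f_\eta(c)$ ($\eta<\lambda$) if it exists and NaC otherwise; $f_\theta$ is the terminal labelling. The sequence is convergent over $f_0$ if $f_\theta$ is legal, and universally convergent if it is convergent over the identity labelling (each cell labelled by itself). $\vec\sigma\sim\vec\tau$ iff they give the same terminal configuration from every configuration. $\mathrm{uc}_L$ is the set of universally convergent basic sequences under concatenation ($\vec\tau\vec\sigma$ means $\vec\sigma$ then $\vec\tau$), and $\mathrm{UC}_L=\mathrm{uc}_L/{\sim}$. -}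

module Defs where

open import Level using (Level; _⊔_; 0ℓ) renaming (suc to lsuc)
open import Algebra.Bundles using (Group)
open import Algebra.Structures using (IsGroup)
open import Axiom.ExcludedMiddle using (ExcludedMiddle)
open import Data.Fin using (Fin; toℕ)
import Data.Fin as Fin
import Data.Fin.Induction as Fin
import Data.Fin.Properties as Fin
open import Data.Fin.Permutation using (Permutation′) renaming (_≈_ to _≈ₚ_)
open import Data.Maybe using (Maybe; just; nothing)
open import Data.Nat using (ℕ; zero; suc; _≤_; _<_)
open import Data.Nat.Divisibility using (_∣_)
open import Data.Product using (_×_; _,_; proj₁; Σ; Σ-syntax; ∃; ∃-syntax)
open import Data.Product.Relation.Binary.Lex.Strict
  using (×-Lex; ×-isStrictTotalOrder; ×-wellFounded)
open import Data.Product.Relation.Binary.Pointwise.NonDependent using (≡×≡⇒≡; ≡⇒≡×≡)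
open import Data.Sum using (_⊎_; [_,_]′)
open import Data.Sum.Relation.Binary.LeftOrder
  using (_⊎-<_; ⊎-<-isStrictTotalOrder; ⊎-<-wellFounded)
open import Data.Sum.Relation.Binary.Pointwise using (Pointwise-≡⇒≡; ≡⇒Pointwise-≡)
open import Function using (_∘_; _on_; _↔_; _⇔_; mk↔ₛ′; Inverse)
open import Function.Construct.Composition using (_↔-∘_)
open import Function.Construct.Identity using (↔-id)
open import Induction.WellFounded using (WellFounded)
open import Relation.Binary.Construct.Add.Supremum.Strict using (_<⁺_)
open import Relation.Binary.Core using (Rel)
open import Relation.Binary.Definitions using (Trichotomous; tri<; tri≈; tri>)
open import Relation.Binary.PropositionalEquality
  using (_≡_; _≢_; _≗_; refl; sym; trans; cong; isEquivalence)
open import Relation.Binary.Structures using (IsStrictTotalOrder)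
open import Relation.Binary.Structures.Biased using (isStrictTotalOrderᶜ)
open import Relation.Nullary using (¬_; yes; no; contradiction)
open import Relation.Nullary.Construct.Add.Supremum using (_⁺; [_]; ⊤⁺)
open import Relation.Unary using (Pred)

Infinite : ∀ {ℓ} → Set ℓ → Set ℓ
Infinite A = ¬ (∃[ n ] A ↔ Fin n)

infixr 8 _^_

_^_ : ∀ {a} {A : Set a} → A ↔ A → ℕ → A ↔ A
T ^ zero  = ↔-id _
T ^ suc n = T ↔-∘ (T ^ n)

------------------------------------------------------------------------
-- The least common multiple of the orders of the elements of Sₙ

record IsOrder {n} (π : Permutation′ n) (m : ℕ) : Set where
  field
    positive : 0 < m
    power    : π ^ m ≈ₚ ↔-id _
    least    : ∀ {j} → 0 < j → π ^ j ≈ₚ ↔-id _ → m ≤ j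

record IsLCM (S : Pred ℕ 0ℓ) (k : ℕ) : Set where
  field
    multiple : ∀ {m} → S m → m ∣ k
    least    : ∀ {j} → (∀ {m} → S m → m ∣ j) → k ∣ j

OrderOfSomePermutation : ℕ → Pred ℕ 0ℓ
OrderOfSomePermutation n m = Σ[ π ∈ Permutation′ n ] IsOrder π m

------------------------------------------------------------------------
-- Ordinals, represented by well-ordered sets

record Ordinal (ℓ : Level) : Set (lsuc ℓ) where
  field
    Carrier            : Set ℓ
    below              : Rel Carrier ℓ
    isStrictTotalOrder : IsStrictTotalOrder _≡_ below
    wellFounded        : WellFounded below

-- α ≤ₒ β : α is isomorphic to an initial segment of β.
infix 4 _≤ₒ_

record _≤ₒ_ {a b} (α : Ordinal a) (β : Ordinal b) : Set (a ⊔ b) where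
  private
    module α = Ordinal α
    module β = Ordinal β
  field
    embed     : α.Carrier → β.Carrier
    monotone  : ∀ {x y} → α.below x y → β.below (embed x) (embed y)
    isInitial : ∀ {x y} → β.below y (embed x) → ∃[ z ] embed z ≡ y

private
  -- The standard library orders sums and products relative to a
  -- componentwise equality, which is then replaced by _≡_.
  replaceEquality : ∀ {a e r} {A : Set a} {_≈_ : Rel A e} {_<′_ : Rel A r} →
                    (∀ {x y} → x ≈ y → x ≡ y) → (∀ {x y} → x ≡ y → x ≈ y) →
                    IsStrictTotalOrder _≈_ _<′_ → IsStrictTotalOrder _≡_ _<′_
  replaceEquality {_<′_ = _<′_} to from sto = isStrictTotalOrderᶜ record
    { isEquivalence = isEquivalence
    ; trans         = sto.trans
    ; compare       = compare
    }
    where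
    module sto = IsStrictTotalOrder sto
    compare : Trichotomous _≡_ _<′_
    compare x y with sto.compare x y
    ... | tri< a ¬b ¬c = tri< a (¬b ∘ from) ¬c
    ... | tri≈ ¬a b ¬c = tri≈ ¬a (to b) ¬c
    ... | tri> ¬a ¬b c = tri> ¬a (¬b ∘ from) c

infixl 6 _+ₒ_
infixl 7 _·ₒ_

_+ₒ_ : ∀ {a b} → Ordinal a → Ordinal b → Ordinal (a ⊔ b)
α +ₒ β = record
  { Carrier            = α.Carrier ⊎ β.Carrier
  ; below              = α.below ⊎-< β.below
  ; isStrictTotalOrder = replaceEquality Pointwise-≡⇒≡ ≡⇒Pointwise-≡
                           (⊎-<-isStrictTotalOrder α.isStrictTotalOrder β.isStrictTotalOrder)
  ; wellFounded        = ⊎-<-wellFounded α.wellFounded β.wellFounded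
  }
  where
  module α = Ordinal α
  module β = Ordinal β

-- α ·ₒ β is α repeated β times, so the β-component is the most
-- significant one.
_·ₒ_ : ∀ {a b} → Ordinal a → Ordinal b → Ordinal (a ⊔ b)
α ·ₒ β = record
  { Carrier            = β.Carrier × α.Carrier
  ; below              = ×-Lex _≡_ β.below α.below
  ; isStrictTotalOrder = replaceEquality ≡×≡⇒≡ ≡⇒≡×≡
                           (×-isStrictTotalOrder β.isStrictTotalOrder α.isStrictTotalOrder)
  ; wellFounded        = ×-wellFounded β.wellFounded α.wellFounded
  }
  where
  module α = Ordinal α
  module β = Ordinal β

finite : ℕ → Ordinal 0ℓ
finite n = record
  { Carrier            = Fin n
  ; below              = Fin._<_
  ; isStrictTotalOrder = Fin.<-isStrictTotalOrder
  ; wellFounded        = Fin.<-wellFounded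
  }

-- Stage θ is the set of ordinals η ≤ θ : an element ξ of θ gives the
-- stage [ ξ ] at which exactly the moves indexed below ξ have been made,
-- and ⊤⁺ is θ itself.
module Stages {ℓ} (θ : Ordinal ℓ) where
  open Ordinal θ

  Stage : Set ℓ
  Stage = Carrier ⁺

  infix 4 _<ₛ_

  _<ₛ_ : Rel Stage ℓ
  _<ₛ_ = _<⁺_ below

  IsZero : Stage → Set ℓ
  IsZero s = ∀ ξ → ¬ ([ ξ ] <ₛ s)

  -- s = ξ + 1
  IsSuccessorOf : Carrier → Stage → Set ℓ
  IsSuccessorOf ξ s = [ ξ ] <ₛ s × (∀ ζ → below ξ ζ → ¬ ([ ζ ] <ₛ s))

  IsLimit : Stage → Set ℓ
  IsLimit s = ¬ IsZero s × (∀ ξ → ¬ IsSuccessorOf ξ s)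

------------------------------------------------------------------------
-- The edged cube

data Axis : Set where
  xAxis yAxis zAxis : Axis

data Colour : Set where
  red white green orange yellow blue : Colour

-- Excluded middle decides whether a point lies on a layer; no structure
-- on L is assumed.
module EdgedCube {ℓ} (em : ExcludedMiddle ℓ) (L : Set ℓ) where

  data L† : Set ℓ where
    neg pos : L → L†
    origin  : L†

  data L̄† : Set ℓ where
    -∞ +∞ : L̄†
    fin   : L† → L̄†

  infix 8 -_

  -_ : L̄† → L̄†
  - -∞           = +∞
  - +∞           = -∞
  - fin (neg r)  = fin (pos r)
  - fin (pos r)  = fin (neg r)
  - fin origin   = fin origin

  record Point : Set ℓ where
    constructor ⟨_,_,_⟩
    field
      px py pz : L̄†

  coord : Axis → Point → L̄†
  coord xAxis = Point.px
  coord yAxis = Point.py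
  coord zAxis = Point.pz

  data AtInfinity : L̄† → Set where
    minus : AtInfinity -∞
    plus  : AtInfinity +∞

  -- AtInfinity is proof-irrelevant, so a cell amounts to a pair (p , i).
  record Cell : Set ℓ where
    constructor cell
    field
      point  : Point
      mark   : Axis
      onFace : AtInfinity (coord mark point)

  open Cell public

  negAtInfinity : ∀ {a} → AtInfinity a → AtInfinity (- a)
  negAtInfinity minus = plus
  negAtInfinity plus  = minus

  rotate : Axis → Cell → Cell
  rotate xAxis (cell ⟨ a , b , c ⟩ xAxis e) = cell ⟨ a , - c , b ⟩ xAxis e
  rotate xAxis (cell ⟨ a , b , c ⟩ yAxis e) = cell ⟨ a , - c , b ⟩ zAxis e
  rotate xAxis (cell ⟨ a , b , c ⟩ zAxis e) = cell ⟨ a , - c , b ⟩ yAxis (negAtInfinity e)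
  rotate yAxis (cell ⟨ a , b , c ⟩ xAxis e) = cell ⟨ c , b , - a ⟩ zAxis (negAtInfinity e)
  rotate yAxis (cell ⟨ a , b , c ⟩ yAxis e) = cell ⟨ c , b , - a ⟩ yAxis e
  rotate yAxis (cell ⟨ a , b , c ⟩ zAxis e) = cell ⟨ c , b , - a ⟩ xAxis e
  rotate zAxis (cell ⟨ a , b , c ⟩ xAxis e) = cell ⟨ - b , a , c ⟩ yAxis e
  rotate zAxis (cell ⟨ a , b , c ⟩ yAxis e) = cell ⟨ - b , a , c ⟩ xAxis (negAtInfinity e)
  rotate zAxis (cell ⟨ a , b , c ⟩ zAxis e) = cell ⟨ - b , a , c ⟩ zAxis e

  rotate⁻¹ : Axis → Cell → Cell
  rotate⁻¹ i c = rotate i (rotate i (rotate i c))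

  neg-involutive : ∀ a → - - a ≡ a
  neg-involutive -∞            = refl
  neg-involutive +∞            = refl
  neg-involutive (fin (neg _)) = refl
  neg-involutive (fin (pos _)) = refl
  neg-involutive (fin origin)  = refl

  onFace-irrelevant : ∀ {a} (e e′ : AtInfinity a) → e ≡ e′
  onFace-irrelevant minus minus = refl
  onFace-irrelevant plus  plus  = refl

  cell-≡ : ∀ {p q i e e′} → p ≡ q → cell p i e ≡ cell q i e′
  cell-≡ {p} {i = i} refl = cong (cell p i) (onFace-irrelevant _ _)

  point-≡ : ∀ {a a′ b b′ c c′} → a ≡ a′ → b ≡ b′ → c ≡ c′ →
            ⟨ a , b , c ⟩ ≡ ⟨ a′ , b′ , c′ ⟩
  point-≡ refl refl refl = refl

  rotate⁴ : ∀ i c → rotate i (rotate i (rotate i (rotate i c))) ≡ c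
  rotate⁴ xAxis (cell ⟨ _ , b , c ⟩ xAxis e) = cell-≡ (point-≡ refl (neg-involutive b) (neg-involutive c))
  rotate⁴ xAxis (cell ⟨ _ , b , c ⟩ yAxis e) = cell-≡ (point-≡ refl (neg-involutive b) (neg-involutive c))
  rotate⁴ xAxis (cell ⟨ _ , b , c ⟩ zAxis e) = cell-≡ (point-≡ refl (neg-involutive b) (neg-involutive c))
  rotate⁴ yAxis (cell ⟨ a , _ , c ⟩ xAxis e) = cell-≡ (point-≡ (neg-involutive a) refl (neg-involutive c))
  rotate⁴ yAxis (cell ⟨ a , _ , c ⟩ yAxis e) = cell-≡ (point-≡ (neg-involutive a) refl (neg-involutive c))
  rotate⁴ yAxis (cell ⟨ a , _ , c ⟩ zAxis e) = cell-≡ (point-≡ (neg-involutive a) refl (neg-involutive c))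
  rotate⁴ zAxis (cell ⟨ a , b , _ ⟩ xAxis e) = cell-≡ (point-≡ (neg-involutive a) (neg-involutive b) refl)
  rotate⁴ zAxis (cell ⟨ a , b , _ ⟩ yAxis e) = cell-≡ (point-≡ (neg-involutive a) (neg-involutive b) refl)
  rotate⁴ zAxis (cell ⟨ a , b , _ ⟩ zAxis e) = cell-≡ (point-≡ (neg-involutive a) (neg-involutive b) refl)

  rotate-coord : ∀ i c → coord i (point (rotate i c)) ≡ coord i (point c)
  rotate-coord xAxis (cell _ xAxis _) = refl
  rotate-coord xAxis (cell _ yAxis _) = refl
  rotate-coord xAxis (cell _ zAxis _) = refl
  rotate-coord yAxis (cell _ xAxis _) = refl
  rotate-coord yAxis (cell _ yAxis _) = refl
  rotate-coord yAxis (cell _ zAxis _) = refl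
  rotate-coord zAxis (cell _ xAxis _) = refl
  rotate-coord zAxis (cell _ yAxis _) = refl
  rotate-coord zAxis (cell _ zAxis _) = refl

  rotate⁻¹-coord : ∀ i c → coord i (point (rotate⁻¹ i c)) ≡ coord i (point c)
  rotate⁻¹-coord i c = trans (rotate-coord i _) (trans (rotate-coord i _) (rotate-coord i _))

  -- Apply g to the cells of the layer p_i = α only.
  onLayer : Axis → L̄† → (Cell → Cell) → Cell → Cell
  onLayer i α g c with em {P = coord i (point c) ≡ α}
  ... | yes _ = g c
  ... | no  _ = c

  onLayer-inverse : ∀ i α (g h : Cell → Cell) → (∀ c → g (h c) ≡ c) →
                    (∀ c → coord i (point (h c)) ≡ coord i (point c)) →
                    ∀ c → onLayer i α g (onLayer i α h c) ≡ c
  onLayer-inverse i α g h gh coord-h c with em {P = coord i (point c) ≡ α}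
  onLayer-inverse i α g h gh coord-h c | yes c∈α with em {P = coord i (point (h c)) ≡ α}
  ... | yes _    = gh c
  ... | no  hc∉α = contradiction (trans (coord-h c) c∈α) hc∉α
  onLayer-inverse i α g h gh coord-h c | no c∉α with em {P = coord i (point c) ≡ α}
  ... | yes c∈α = contradiction c∈α c∉α
  ... | no  _   = refl

  quarterTurn : Axis → L̄† → Cell ↔ Cell
  quarterTurn i α = mk↔ₛ′ (onLayer i α (rotate i)) (onLayer i α (rotate⁻¹ i))
    (onLayer-inverse i α (rotate i) (rotate⁻¹ i) (rotate⁴ i) (rotate⁻¹-coord i))
    (onLayer-inverse i α (rotate⁻¹ i) (rotate i) (rotate⁴ i) (rotate-coord i))

  -- T ^ suc extraTurns, that is T, T² or T³, for the quarter turn T.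
  record BasicTwist : Set ℓ where
    field
      axis       : Axis
      layer      : L̄†
      extraTurns : Fin 3

  permutation : BasicTwist → Cell ↔ Cell
  permutation σ = quarterTurn axis layer ^ suc (toℕ extraTurns)
    where open BasicTwist σ

  -- The value NaC is represented by nothing.
  Labelling : ∀ {a} → Set a → Set (ℓ ⊔ a)
  Labelling X = Cell → Maybe X

  Legal : ∀ {a} {X : Set a} → Labelling X → Set (ℓ ⊔ a)
  Legal f = ∀ c → f c ≢ nothing

  Configuration : Set ℓ
  Configuration = Labelling Colour

  faceColour : ∀ {a} → Axis → AtInfinity a → Colour
  faceColour xAxis plus  = red
  faceColour yAxis plus  = blue
  faceColour zAxis plus  = white
  faceColour xAxis minus = orange
  faceColour yAxis minus = green
  faceColour zAxis minus = yellow

  solved : Configuration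
  solved c = just (faceColour (mark c) (onFace c))

  identityLabelling : Labelling Cell
  identityLabelling = just

  infixr 7 _▷_

  _▷_ : ∀ {a} {X : Set a} → BasicTwist → Labelling X → Labelling X
  (σ ▷ f) c = f (Inverse.from (permutation σ) c)

  record BasicSequence : Set (lsuc ℓ) where
    field
      length : Ordinal ℓ
      twist  : Ordinal.Carrier length → BasicTwist

  open BasicSequence public

  -- f s, for s ≤ θ, are the labellings produced from f₀ by transfinite
  -- recursion along σ; they are determined up to pointwise equality.
  module _ {a} {X : Set a} (σ : BasicSequence) (f₀ : Labelling X) where
    open Ordinal (length σ) using (Carrier; below)
    open Stages (length σ)

    EventuallyAt : (Stage → Labelling X) → Stage → Cell → Maybe X → Set (ℓ ⊔ a)
    EventuallyAt f s c v =
      Σ[ β ∈ Carrier ] [ β ] <ₛ s × (∀ η → below β η → [ η ] <ₛ s → f [ η ] c ≡ v)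

    record IsRun (f : Stage → Labelling X) : Set (ℓ ⊔ a) where
      field
        start     : ∀ s → IsZero s → f s ≗ f₀
        successor : ∀ ξ s → IsSuccessorOf ξ s → f s ≗ twist σ ξ ▷ f [ ξ ]
        limit     : ∀ s → IsLimit s → ∀ c v → EventuallyAt f s c v → f s c ≡ v
        limit-NaC : ∀ s → IsLimit s → ∀ c → ¬ (∃[ v ] EventuallyAt f s c v) →
                    f s c ≡ nothing

    Terminal : Labelling X → Set (ℓ ⊔ a)
    Terminal g = Σ[ f ∈ (Stage → Labelling X) ] IsRun f × f ⊤⁺ ≗ g

    ConvergentOver : Set (ℓ ⊔ a)
    ConvergentOver = Σ[ g ∈ Labelling X ] Terminal g × Legal g

  UniversallyConvergent : BasicSequence → Set ℓ
  UniversallyConvergent σ = ConvergentOver σ identityLabelling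

  ConvergentOverSolved : BasicSequence → Set ℓ
  ConvergentOverSolved σ = ConvergentOver σ solved

  infix 4 _∼_

  _∼_ : Rel BasicSequence ℓ
  σ ∼ τ = ∀ (f g : Configuration) → Terminal σ f g ⇔ Terminal τ f g

  -- First σ, then τ.
  infixr 9 _⊙_

  _⊙_ : BasicSequence → BasicSequence → BasicSequence
  τ ⊙ σ = record
    { length = length σ +ₒ length τ
    ; twist  = [ twist σ , twist τ ]′
    }

  -- The sequences satisfying P, taken modulo _∼_, form a group under the
  -- operation induced by concatenation.
  record GroupModulo∼ (P : BasicSequence → Set ℓ) : Set (lsuc ℓ) where
    field
      closed : ∀ {τ σ} → P τ → P σ → P (τ ⊙ σ)

    Element : Set (lsuc ℓ)
    Element = Σ BasicSequence P

    _∙_ : Element → Element → Element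
    (τ , p) ∙ (σ , q) = τ ⊙ σ , closed p q

    field
      ε       : Element
      _⁻¹     : Element → Element
      isGroup : IsGroup (_∼_ on proj₁) _∙_ ε _⁻¹

    group : Group (lsuc ℓ) ℓ
    group = record { isGroup = isGroup }

{-# OPTIONS --safe #-}

-- A run is tracked if every cell has, at every stage, a well-defined cell of
-- origin; being tracked is equivalent to universal convergence.  Cells move
-- within orbits of at most 24 cells, so a NaC entry can never disappear from an
-- orbit, and a run that ends legally is legal throughout.  Suppose that a run
-- over the solved configuration is legal and is tracked below a limit stage λ.
-- Each layer contains an edge or corner cubie moved by every twist of the layer,
-- and the colours of two of its cells eventually become constant.  These two
-- colours, together with the coordinate of the cubie in the oriented frame of
-- the two faces, determine the origin of the cells, so late twists of the layer
-- would be visible: every layer is twisted only boundedly often before λ.  As a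
-- cell lies on three layers, it eventually stops moving, and the run is tracked
-- at λ.  A tracked run acts on configurations by an injection of the cells that
-- preserves orbits, which extends to permutations of 24 points; hence a power of
-- the sequence undoes it.

module Submission where

open import Defs
open import Algebra.Bundles using (Group)
open import Algebra.Morphism.Structures using (module GroupMorphisms)
open import Axiom.ExcludedMiddle using (ExcludedMiddle)
open import Data.Empty.Polymorphic using (⊥)
open import Data.Fin using (Fin; zero; suc; toℕ; combine; remQuot)
open import Data.Fin.Patterns using (0F; 1F; 2F; 3F; 4F; 5F)
open import Data.Fin.Permutation using (Permutation′; _⟨$⟩ʳ_)
  renaming (_≈_ to _≈ₚ_; permutation to mkPermutation)
import Data.Fin.Properties as Fin
open import Data.Maybe using (Maybe; just; nothing)
open import Data.Maybe.Properties using (just-injective)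
open import Data.Nat
  using (ℕ; zero; suc; pred; _+_; _*_; _∸_; _≤_; _<_; z<s; s<s; s≤s; _!; NonZero; >-nonZero)
open import Data.Nat.Divisibility
  using (_∣_; divides; ∣-trans; m≤n⇒m!∣n!; m%n≡0⇒n∣m; m∣m*n; 0∣⇒≡0)
open import Data.Nat.DivMod using (_%_; _/_; m≡m%n+[m/n]*n; m%n<n)
open import Data.Nat.GeneralisedArithmetic using (fold; fold-+; iterate)
open import Data.Nat.Induction using (<-rec)
import Data.Nat.Properties as ℕ
open import Data.Product using (_×_; _,_; proj₁; proj₂; Σ-syntax; ∃-syntax)
open import Data.Sum using (_⊎_; inj₁; inj₂)
open import Data.Sum.Relation.Binary.LeftOrder using (₁∼₁; ₁∼₂; ₂∼₂)
open import Function using (_∘_; id; mk⇔; Inverse)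
open import Function.Bundles using (_⇔_; Equivalence)
open import Function.Construct.Composition using (_⇔-∘_)
open import Function.Construct.Identity using (⇔-id; ↔-id)
open import Function.Construct.Symmetry using (⇔-sym)
open import Function.Definitions using (Injective)
open import Induction.WellFounded using (Acc; acc)
open import Level using (_⊔_)
open import Relation.Binary.Construct.Add.Supremum.Strict
  using ([_]; [_]<⊤⁺; [<]-injective; <⁺-trans)
open import Relation.Binary.Core using (Rel)
open import Relation.Binary.Definitions using (DecidableEquality; tri<; tri≈; tri>)
open import Relation.Binary.PropositionalEquality
open import Relation.Binary.Structures using (IsStrictTotalOrder)
open import Relation.Nullary using (¬_; Dec; yes; no; contradiction)
open import Relation.Nullary.Construct.Add.Supremum using ([_]; ⊤⁺)
open import Relation.Nullary.Decidable using (_×-dec_)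
open import Relation.Unary using (Pred; Decidable)

-- Finite permutations and the least common multiple of their orders

module _ {a} {A : Set a} {h : A → A} where

  fold-comm : ∀ x n → fold (h x) h n ≡ h (fold x h n)
  fold-comm x zero    = refl
  fold-comm x (suc n) = cong h (fold-comm x n)

  fold-∣ : ∀ {x r n} → fold x h r ≡ x → r ∣ n → fold x h n ≡ x
  fold-∣ {x} {r} period (divides q refl) = go q
    where
    go : ∀ q → fold x h (q * r) ≡ x
    go zero    = refl
    go (suc q) = trans (fold-+ x h r) (trans (cong (λ y → fold y h r) (go q)) period)

  fold-cancel : Injective _≡_ _≡_ h → ∀ {x m n} → m ≤ n →
                fold x h m ≡ fold x h n → fold x h (n ∸ m) ≡ x
  fold-cancel inj {m = zero}              _         eq = sym eq
  fold-cancel inj {m = suc m} {n = suc n} (s≤s m≤n) eq = fold-cancel inj m≤n (inj eq)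

  -- Pigeonhole on the indices in `orbit` of the first `suc n` iterates gives two equal iterates;
  -- injectivity then cancels the earlier one. Repetitions in `orbit` do no harm.
  return : Injective _≡_ _≡_ h → ∀ {n x} (orbit : Fin n → A) →
           (∀ m → ∃[ i ] orbit i ≡ fold x h m) →
           ∃[ r ] suc r ≤ n × fold x h (suc r) ≡ x
  return inj {n} {x} orbit covers
    with i , j , i<j , eq ← Fin.pigeonhole (ℕ.n<1+n n) (λ i → proj₁ (covers (toℕ i)))
    with toℕ j ∸ toℕ i in diff | fold-cancel inj {x} (ℕ.<⇒≤ i<j) (trans (sym (proj₂ (covers (toℕ i))))
           (trans (cong orbit eq) (proj₂ (covers (toℕ j)))))
  ... | zero  | _      = contradiction (ℕ.m∸n≡0⇒m≤n diff) (ℕ.<⇒≱ i<j)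
  ... | suc r | period = r , bound , period
    where
    bound : suc r ≤ n
    bound = subst (_≤ n) diff (ℕ.≤-trans (ℕ.m∸n≤m (toℕ j) (toℕ i)) (Fin.toℕ≤pred[n] j))

  -- Return times vary with the point but are at most `n`, so `n !` is a multiple of each of them:
  -- one exponent serves all points.
  fold-! : Injective _≡_ _≡_ h → ∀ {n x} (orbit : Fin n → A) →
           (∀ m → ∃[ i ] orbit i ≡ fold x h m) → fold x h (n !) ≡ x
  fold-! inj orbit covers with r , r<n , period ← return inj orbit covers =
    fold-∣ {r = suc r} period (∣-trans (m∣m*n {suc r} (r !)) (m≤n⇒m!∣n! r<n))

-- Abstract, so that 24 ! is never evaluated.
abstract
  exponent : ℕ → ℕ
  exponent n = pred (n !)

  fold-exponent : ∀ {a} {A : Set a} {h : A → A} → Injective _≡_ _≡_ h → ∀ {n x} (orbit : Fin n → A) →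
                  (∀ m → ∃[ i ] orbit i ≡ fold x h m) → fold x h (suc (exponent n)) ≡ x
  fold-exponent {h = h} inj {n} {x} orbit covers =
    subst (λ m → fold x h m ≡ x) (sym (ℕ.suc-pred (n !) {{n ℕ.!≢0}})) (fold-! inj orbit covers)

injective⇒permutation : ∀ {n} {f : Fin n → Fin n} → Injective _≡_ _≡_ f →
                        Σ[ π ∈ Permutation′ n ] (∀ i → π ⟨$⟩ʳ i ≡ f i)
injective⇒permutation {n} {f} inj =
  mkPermutation f f⁻¹ f∘f⁻¹ (λ i → inj (f∘f⁻¹ (f i))) , λ _ → refl
  where
  returns : ∀ i → ∃[ r ] suc r ≤ n × fold i f (suc r) ≡ i
  returns i = return inj id (λ m → fold i f m , refl)
  f⁻¹ : Fin n → Fin n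
  -- The point `i` recurs after `suc r` steps, so stopping one step earlier gives a preimage.
  f⁻¹ i = fold i f (proj₁ (returns i))
  f∘f⁻¹ : ∀ i → f (f⁻¹ i) ≡ i
  f∘f⁻¹ i = proj₂ (proj₂ (returns i))

^-fold : ∀ {n} (π : Permutation′ n) m i → (π ^ m) ⟨$⟩ʳ i ≡ fold i (π ⟨$⟩ʳ_) m
^-fold π zero    i = refl
^-fold π (suc m) i = cong (π ⟨$⟩ʳ_) (^-fold π m i)

permutation-injective : ∀ {n} (π : Permutation′ n) → Injective _≡_ _≡_ (π ⟨$⟩ʳ_)
permutation-injective π {i} {j} eq =
  trans (sym (Inverse.strictlyInverseʳ π i)) (trans (cong (Inverse.from π) eq) (Inverse.strictlyInverseʳ π j))

π^n!≈id : ∀ {n} (π : Permutation′ n) → π ^ (n !) ≈ₚ ↔-id _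
π^n!≈id {n} π i =
  trans (^-fold π (n !) i) (fold-! (permutation-injective π) id (λ m → fold i (π ⟨$⟩ʳ_) m , refl))

least-witness : ∀ {p} {P : Pred ℕ p} → Decidable P → ∀ n → P n → ∃[ m ] P m × (∀ {j} → P j → m ≤ j)
least-witness {P = P} P? = <-rec _ go
  where
  go : ∀ n → (∀ {m} → m < n → P m → ∃[ m ] P m × (∀ {j} → P j → m ≤ j)) →
       P n → ∃[ m ] P m × (∀ {j} → P j → m ≤ j)
  go n rec Pn with ℕ.anyUpTo? P? n
  ... | yes (m , m<n , Pm) = rec m<n Pm
  ... | no none            = n , Pn , λ {j} Pj → ℕ.≮⇒≥ (λ j<n → none (j , j<n , Pj))

order : ∀ {n} (π : Permutation′ n) → ∃[ m ] IsOrder π m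
order {n} π =
  let m , (m>0 , π^m≈id) , smallest = least-witness isPeriod? (n !) (ℕ.1≤n! n , π^n!≈id π)
  in m , record { positive = m>0 ; power = π^m≈id ; least = λ j>0 π^j≈id → smallest (j>0 , π^j≈id) }
  where
  IsPeriod : Pred ℕ _
  IsPeriod j = 0 < j × π ^ j ≈ₚ ↔-id _
  isPeriod? : Decidable IsPeriod
  isPeriod? j = (0 ℕ.<? j) ×-dec Fin.all? (λ i → (π ^ j) ⟨$⟩ʳ i Fin.≟ i)

-- The remainder `j % m` is again an exponent that kills `π`; it is smaller than `m`, so minimality
-- makes it zero.
order-∣ : ∀ {n} {π : Permutation′ n} {m j} → IsOrder π m → π ^ j ≈ₚ ↔-id _ → m ∣ j
order-∣ {π = π} {m} {j} isOrder π^j≈id = m%n≡0⇒n∣m j m remainder≡0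
  where
  open IsOrder isOrder
  instance
    m≢0 : NonZero m
    m≢0 = >-nonZero positive
  π^r≈id : π ^ (j % m) ≈ₚ ↔-id _
  π^r≈id i = begin
    (π ^ (j % m)) ⟨$⟩ʳ i                          ≡⟨ ^-fold π (j % m) i ⟩
    fold i h (j % m)                              ≡⟨ cong (λ x → fold x h (j % m)) multiple ⟨
    fold (fold i h (j / m * m)) h (j % m)         ≡⟨ fold-+ i h (j % m) ⟨
    fold i h (j % m + j / m * m)                  ≡⟨ cong (fold i h) (m≡m%n+[m/n]*n j m) ⟨
    fold i h j                                    ≡⟨ ^-fold π j i ⟨
    (π ^ j) ⟨$⟩ʳ i                                ≡⟨ π^j≈id i ⟩
    i                                             ∎
    where
    open ≡-Reasoning
    h = π ⟨$⟩ʳ_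
    multiple : fold i h (j / m * m) ≡ i
    multiple = fold-∣ (trans (sym (^-fold π m i)) (power i)) (divides (j / m) refl)
  remainder≡0 : j % m ≡ 0
  remainder≡0 with j % m | π^r≈id | m%n<n j m
  ... | zero  | _  | _   = refl
  ... | suc r | eq | r<m = contradiction (least z<s eq) (ℕ.<⇒≱ r<m)

module _ {n k} (isLCM : IsLCM (OrderOfSomePermutation n) k) where

  -- The number `n !` is itself a common multiple, so `k` divides something nonzero. This keeps the
  -- exponent `k ∸ 1` from being truncated.
  lcm-positive : 0 < k
  lcm-positive = ℕ.n≢0⇒n>0 λ { refl → ℕ.m<n⇒n≢0 (ℕ.1≤n! n) (0∣⇒≡0 k∣n!) }
    where
    k∣n! : k ∣ n !
    k∣n! = IsLCM.least isLCM λ (π , isOrder) → order-∣ isOrder (π^n!≈id π)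

  fold-lcm : ∀ {f : Fin n → Fin n} → Injective _≡_ _≡_ f → ∀ i → fold i f k ≡ i
  fold-lcm {f} inj i with π , π≗f ← injective⇒permutation inj
                     with m , isOrder ← order π = fold-∣ period (IsLCM.multiple isLCM (π , isOrder))
    where
    fold-cong : ∀ m → fold i (π ⟨$⟩ʳ_) m ≡ fold i f m
    fold-cong zero    = refl
    fold-cong (suc m) = trans (π≗f _) (cong f (fold-cong m))
    period : fold i f m ≡ i
    period = trans (sym (fold-cong m)) (trans (sym (^-fold π m i)) (IsOrder.power isOrder i))

  -- An injection h of a set with at most n elements extends to an injection of
  -- Fin n : it acts on one chosen index for each element and fixes the others.
  module _ {a} {A : Set a} (_≟_ : DecidableEquality A) {h : A → A} (inj : Injective _≡_ _≡_ h)
           (orbit : Fin n → A) (closed : ∀ g → ∃[ g′ ] orbit g′ ≡ h (orbit g)) where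

    private
      representative : ∀ d → ∃[ g ] orbit g ≡ d → Fin n
      representative d some with Fin.any? (λ g → orbit g ≟ d)
      ... | yes (g , _) = g
      ... | no  none    = contradiction some none

      orbit-representative : ∀ {d} some → orbit (representative d some) ≡ d
      orbit-representative {d} some with Fin.any? (λ g → orbit g ≟ d)
      ... | yes (_ , eq) = eq
      ... | no  none     = contradiction some none

      -- The search for an index looks only at the element, so neither the proof of its occurrence
      -- nor repetitions in `orbit` affect the outcome.
      representative-unique : ∀ {d d′} some some′ → d ≡ d′ → representative d some ≡ representative d′ some′
      representative-unique {d} some some′ refl with Fin.any? (λ g → orbit g ≟ d)
      ... | yes _    = refl
      ... | no  none = contradiction some none

      rep next : Fin n → Fin n
      rep  g = representative (orbit g) (g , refl)
      next g = representative (h (orbit g)) (closed g)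

      orbit-next : ∀ g → orbit (next g) ≡ h (orbit g)
      orbit-next g = orbit-representative (closed g)

      rep-representative : ∀ {d} some → rep (representative d some) ≡ representative d some
      rep-representative some = representative-unique _ some (orbit-representative some)

      extension : Fin n → Fin n
      extension g with rep g Fin.≟ g
      ... | yes _ = next g
      ... | no  _ = g

      extension-rep : ∀ {g} → rep g ≡ g → extension g ≡ next g
      extension-rep {g} isRep with rep g Fin.≟ g
      ... | yes _   = refl
      ... | no  ¬rep = contradiction isRep ¬rep

      -- Chosen indices go to chosen indices and the others stay fixed, so a mixed collision is
      -- impossible; a collision of two chosen indices reduces to injectivity of `h`.
      extension-injective : Injective _≡_ _≡_ extension
      extension-injective {g} {g′} eq with rep g Fin.≟ g | rep g′ Fin.≟ g′
      ... | yes g-rep | yes g′-rep = trans (sym g-rep) (trans (representative-unique _ _ (inj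
              (trans (sym (orbit-next g)) (trans (cong orbit eq) (orbit-next g′))))) g′-rep)
      ... | yes _     | no  ¬rep   = contradiction (subst (λ g → rep g ≡ g) eq (rep-representative (closed g))) ¬rep
      ... | no  ¬rep  | yes _      = contradiction (subst (λ g → rep g ≡ g) (sym eq) (rep-representative (closed g′))) ¬rep
      ... | no  _     | no  _      = eq

      fold-extension : ∀ {g} → rep g ≡ g → ∀ m → let g′ = fold g extension m in
                       rep g′ ≡ g′ × orbit g′ ≡ fold (orbit g) h m
      fold-extension g-rep zero    = g-rep , refl
      fold-extension {g} g-rep (suc m) with g′-rep , eq ← fold-extension {g} g-rep m
        rewrite extension-rep g′-rep = rep-representative (closed _) , trans (orbit-next _) (cong h eq)

    -- Starting from a chosen index, the iterates of `extension` shadow those of `h`, so the period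
    -- given by `fold-lcm` carries over.
    fold-lcm-orbit : ∀ g → fold (orbit g) h k ≡ orbit g
    fold-lcm-orbit g = subst (λ d → fold d h k ≡ d) (orbit-representative (g , refl))
      (trans (sym (proj₂ (fold-extension (rep-representative (g , refl)) k)))
        (cong orbit (fold-lcm extension-injective (rep g))))

-- Stages

module StageProperties {ℓ} (θ : Ordinal ℓ) where
  open Ordinal θ
  open Stages θ
  open IsStrictTotalOrder isStrictTotalOrder public using (compare) renaming (trans to below-trans)

  <ₛ-trans : ∀ {ξ ζ s} → below ξ ζ → [ ζ ] <ₛ s → [ ξ ] <ₛ s
  <ₛ-trans ξ<ζ = <⁺-trans below below-trans [ ξ<ζ ]

  stage-induction : ∀ {p} (P : Stage → Set p) →
                    (∀ s → (∀ ξ → [ ξ ] <ₛ s → P [ ξ ]) → P s) → ∀ s → P s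
  stage-induction P step = λ { [ ξ ] → go ξ (wellFounded ξ) ; ⊤⁺ → step ⊤⁺ λ ξ _ → go ξ (wellFounded ξ) }
    where
    go : ∀ ξ → Acc below ξ → P [ ξ ]
    go ξ (acc rs) = step [ ξ ] λ ζ ζ<ξ → go ζ (rs ([<]-injective below ζ<ξ))

  successor-unique : ∀ {ξ ζ s} → IsSuccessorOf ξ s → IsSuccessorOf ζ s → ξ ≡ ζ
  successor-unique {ξ} {ζ} (ξ<s , ξ-last) (ζ<s , ζ-last) with compare ξ ζ
  ... | tri< ξ<ζ _ _ = contradiction ζ<s (ξ-last ζ ξ<ζ)
  ... | tri≈ _ ξ≡ζ _ = ξ≡ζ
  ... | tri> _ _ ζ<ξ = contradiction ξ<s (ζ-last ξ ζ<ξ)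

  below-successor : ∀ {ξ ζ s} → IsSuccessorOf ξ s → [ ζ ] <ₛ s → ζ ≡ ξ ⊎ below ζ ξ
  below-successor {ξ} {ζ} (_ , last) ζ<s with compare ζ ξ
  ... | tri< ζ<ξ _ _ = inj₂ ζ<ξ
  ... | tri≈ _ ζ≡ξ _ = inj₁ ζ≡ξ
  ... | tri> _ _ ξ<ζ = contradiction ζ<s (last ζ ξ<ζ)

  Eventually : ∀ {q} → Stage → (Carrier → Set q) → Set (ℓ ⊔ q)
  Eventually s Q = Σ[ β ∈ Carrier ] [ β ] <ₛ s × (∀ η → below β η → [ η ] <ₛ s → Q η)

  eventually-map : ∀ {s q r} {Q : Carrier → Set q} {R : Carrier → Set r} →
                   (∀ η → [ η ] <ₛ s → Q η → R η) → Eventually s Q → Eventually s R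
  eventually-map f (β , β<s , Q-from-β) = β , β<s , λ η β<η η<s → f η η<s (Q-from-β η β<η η<s)

  eventually-× : ∀ {s q r} {Q : Carrier → Set q} {R : Carrier → Set r} →
                 Eventually s Q → Eventually s R → Eventually s (λ η → Q η × R η)
  eventually-× (β , β<s , Qβ) (γ , γ<s , Rγ) with compare β γ
  ... | tri< β<γ _ _ = γ , γ<s , λ η γ<η η<s → Qβ η (below-trans β<γ γ<η) η<s , Rγ η γ<η η<s
  ... | tri≈ _ refl _ = γ , γ<s , λ η γ<η η<s → Qβ η γ<η η<s , Rγ η γ<η η<s
  ... | tri> _ _ γ<β = β , β<s , λ η β<η η<s → Qβ η β<η η<s , Rγ η (below-trans γ<β β<η) η<s

  module Classical (em : ExcludedMiddle ℓ) where

    data Kind (s : Stage) : Set ℓ where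
      zero      : IsZero s → Kind s
      successor : ∀ ξ → IsSuccessorOf ξ s → Kind s
      limit     : IsLimit s → Kind s

    kind : ∀ s → Kind s
    kind s with em {P = IsZero s} | em {P = ∃[ ξ ] IsSuccessorOf ξ s}
    ... | yes isZero | _            = zero isZero
    ... | no  _      | yes (ξ , ξ+) = successor ξ ξ+
    ... | no  nonzero | no none     = limit (nonzero , λ ξ ξ+ → none (ξ , ξ+))

    limit-inhabited : ∀ {s} → IsLimit s → ∃[ ξ ] [ ξ ] <ₛ s
    limit-inhabited {s} (nonzero , _) with em {P = ∃[ ξ ] [ ξ ] <ₛ s}
    ... | yes some = some
    ... | no  none = contradiction (λ ξ ξ<s → none (ξ , ξ<s)) nonzero

    limit-unbounded : ∀ {s β} → IsLimit s → [ β ] <ₛ s → ∃[ η ] below β η × [ η ] <ₛ s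
    limit-unbounded {s} {β} (_ , notSuccessor) β<s with em {P = ∃[ η ] below β η × [ η ] <ₛ s}
    ... | yes some = some
    ... | no  none = contradiction (β<s , λ η β<η η<s → none (η , β<η , η<s)) (notSuccessor β)

    eventually-witness : ∀ {s q} {Q : Carrier → Set q} → IsLimit s → Eventually s Q →
                         ∃[ η ] [ η ] <ₛ s × Q η
    eventually-witness lim (β , β<s , Q-from-β) with η , β<η , η<s ← limit-unbounded lim β<s =
      η , η<s , Q-from-β η β<η η<s

    eventually-beyond : ∀ {s β} → [ β ] <ₛ s → Eventually s (below β)
    eventually-beyond {β = β} β<s = β , β<s , λ _ β<η _ → β<η

    -- Finitely many bounds below `s` have a largest one. The use is for the 24 cells of an orbit.
    eventually-all : ∀ {s q n} {Q : Fin n → Carrier → Set q} → IsLimit s →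
                     (∀ i → Eventually s (Q i)) → Eventually s (λ η → ∀ i → Q i η)
    eventually-all {n = zero} lim _ with β , β<s ← limit-inhabited lim = β , β<s , λ _ _ _ ()
    eventually-all {n = suc n} lim all =
      eventually-map (λ { η _ (Q₀ , Qₛ) zero → Q₀ ; η _ (Q₀ , Qₛ) (suc i) → Qₛ i })
        (eventually-× (all zero) (eventually-all lim (all ∘ suc)))

    -- Well-founded descent from any index strictly above `ξ` ends at the least such index, which is
    -- still below `s`.
    next : ∀ {s ξ} → IsLimit s → [ ξ ] <ₛ s → ∃[ ζ ] [ ζ ] <ₛ s × IsSuccessorOf ξ [ ζ ]
    next {s} {ξ} lim ξ<s with η , ξ<η , η<s ← limit-unbounded lim ξ<s = go η (wellFounded η) ξ<η η<s
      where
      go : ∀ η → Acc below η → below ξ η → [ η ] <ₛ s → ∃[ ζ ] [ ζ ] <ₛ s × IsSuccessorOf ξ [ ζ ]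
      go η (acc rs) ξ<η η<s with em {P = ∃[ ζ ] below ξ ζ × [ ζ ] <ₛ [ η ]}
      ... | yes (ζ , ξ<ζ , [ ζ<η ]) = go ζ (rs ζ<η) ξ<ζ (<ₛ-trans ζ<η η<s)
      ... | no  none = η , η<s , [ ξ<η ] , λ ζ ξ<ζ ζ<η → none (ζ , ξ<ζ , ζ<η)

-- Cells, orbits and linked cells

module Geometry {ℓ} (em : ExcludedMiddle ℓ) (L : Set ℓ) where
  open EdgedCube em L
  open BasicTwist

  OnLayer : BasicTwist → Cell → Set ℓ
  OnLayer σ c = coord (axis σ) (point c) ≡ layer σ

  push pull : BasicTwist → Cell → Cell
  push σ = Inverse.to (permutation σ)
  pull σ = Inverse.from (permutation σ)

  pull-push : ∀ σ c → pull σ (push σ c) ≡ c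
  pull-push σ = Inverse.strictlyInverseʳ (permutation σ)

  pull-injective : ∀ σ {c d} → pull σ c ≡ pull σ d → c ≡ d
  pull-injective σ {c} {d} eq =
    trans (sym (Inverse.strictlyInverseˡ (permutation σ) c))
      (trans (cong (push σ) eq) (Inverse.strictlyInverseˡ (permutation σ) d))

  onLayer-yes : ∀ {i α g c} → coord i (point c) ≡ α → onLayer i α g c ≡ g c
  onLayer-yes {i} {α} {g} {c} c∈α with em {P = coord i (point c) ≡ α}
  ... | yes _   = refl
  ... | no  c∉α = contradiction c∈α c∉α

  onLayer-no : ∀ {i α g c} → coord i (point c) ≢ α → onLayer i α g c ≡ c
  onLayer-no {i} {α} {g} {c} c∉α with em {P = coord i (point c) ≡ α}
  ... | yes c∈α = contradiction c∈α c∉α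
  ... | no  _   = refl

  -- Turning keeps the coordinate along the axis, so the layer test of each further quarter turn
  -- succeeds again.
  pull-on : ∀ σ {c} → OnLayer σ c → pull σ c ≡ iterate (rotate⁻¹ (axis σ)) c (suc (toℕ (extraTurns σ)))
  pull-on σ = go (suc (toℕ (extraTurns σ)))
    where
    go : ∀ m {c} → OnLayer σ c →
         Inverse.from (quarterTurn (axis σ) (layer σ) ^ m) c ≡ iterate (rotate⁻¹ (axis σ)) c m
    go zero    c∈σ = refl
    go (suc m) c∈σ =
      trans (cong (Inverse.from (quarterTurn (axis σ) (layer σ) ^ m)) (onLayer-yes c∈σ))
        (go m (trans (rotate⁻¹-coord (axis σ) _) c∈σ))

  pull-off : ∀ σ {c} → ¬ OnLayer σ c → pull σ c ≡ c
  pull-off σ {c} c∉σ = go (suc (toℕ (extraTurns σ)))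
    where
    go : ∀ m → Inverse.from (quarterTurn (axis σ) (layer σ) ^ m) c ≡ c
    go zero    = refl
    go (suc m) = trans (cong (Inverse.from (quarterTurn (axis σ) (layer σ) ^ m)) (onLayer-no c∉σ)) (go m)

  caseLayer : ∀ {q} {Q : Set q} σ c → (OnLayer σ c → Q) → (¬ OnLayer σ c → Q) → Q
  caseLayer σ c on off with em {P = OnLayer σ c}
  ... | yes c∈σ = on c∈σ
  ... | no  c∉σ = off c∉σ

  iterate-preserves : ∀ {a p} {A : Set a} (P : A → Set p) {h : A → A} →
                      (∀ {x} → P x → P (h x)) → ∀ n {x} → P x → P (iterate h x n)
  iterate-preserves P h-pres zero    Px = Px
  iterate-preserves P h-pres (suc n) Px = iterate-preserves P h-pres n (h-pres Px)

  module _ {p} (P : Cell → Set p) (rotate-pres : ∀ {c} i → P c → P (rotate i c)) where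

    -- On each cell a twist is either the identity or a power of a rotation of the whole cube, so
    -- invariance under rotations suffices.
    pull-preserves : ∀ σ {c} → P c → P (pull σ c)
    pull-preserves σ {c} Pc = caseLayer σ c
      (λ c∈σ → subst P (sym (pull-on σ c∈σ))
        (iterate-preserves P (rotate-pres i ∘ rotate-pres i ∘ rotate-pres i) (suc (toℕ (extraTurns σ))) Pc))
      (λ c∉σ → subst P (sym (pull-off σ c∉σ)) Pc)
      where i = axis σ

    push-preserves : ∀ σ {c} → P c → P (push σ c)
    push-preserves σ = go (suc (toℕ (extraTurns σ)))
      where
      go : ∀ m {c} → P c → P (Inverse.to (quarterTurn (axis σ) (layer σ) ^ m) c)
      go zero    Pc = Pc
      go (suc m) {c} Pc with Inverse.to (quarterTurn (axis σ) (layer σ) ^ m) c | go m Pc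
      ... | d | Pd with em {P = coord (axis σ) (point d) ≡ layer σ}
      ...   | yes _ = rotate-pres (axis σ) Pd
      ...   | no  _ = Pd

  -- On a face, the two coordinates along the face are listed in an order that
  -- is consistent with the orientation of the cube, so that a rotation of the
  -- cube carries them from face to face up to a quarter turn of their plane.
  cellAt : Fin 6 → L̄† × L̄† → Cell
  cellAt 0F (u , v) = cell ⟨ +∞ , u , v ⟩ xAxis plus
  cellAt 1F (u , v) = cell ⟨ -∞ , v , u ⟩ xAxis minus
  cellAt 2F (u , v) = cell ⟨ v , +∞ , u ⟩ yAxis plus
  cellAt 3F (u , v) = cell ⟨ u , -∞ , v ⟩ yAxis minus
  cellAt 4F (u , v) = cell ⟨ u , v , +∞ ⟩ zAxis plus
  cellAt 5F (u , v) = cell ⟨ v , u , -∞ ⟩ zAxis minus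

  locate : ∀ c → Σ[ F ∈ Fin 6 ] Σ[ w ∈ L̄† × L̄† ] cellAt F w ≡ c
  locate (cell ⟨ _ , u , v ⟩ xAxis plus)  = 0F , (u , v) , refl
  locate (cell ⟨ _ , v , u ⟩ xAxis minus) = 1F , (u , v) , refl
  locate (cell ⟨ v , _ , u ⟩ yAxis plus)  = 2F , (u , v) , refl
  locate (cell ⟨ u , _ , v ⟩ yAxis minus) = 3F , (u , v) , refl
  locate (cell ⟨ u , v , _ ⟩ zAxis plus)  = 4F , (u , v) , refl
  locate (cell ⟨ v , u , _ ⟩ zAxis minus) = 5F , (u , v) , refl

  turn : Fin 4 → L̄† × L̄† → L̄† × L̄†
  turn 0F (u , v) = u , v
  turn 1F (u , v) = - v , u
  turn 2F (u , v) = - u , - v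
  turn 3F (u , v) = v , - u

  turn-∘ : ∀ s t w → ∃[ r ] turn r w ≡ turn s (turn t w)
  turn-∘ 0F 0F w       = 0F , refl
  turn-∘ 0F 1F w       = 1F , refl
  turn-∘ 0F 2F w       = 2F , refl
  turn-∘ 0F 3F w       = 3F , refl
  turn-∘ 1F 0F w       = 1F , refl
  turn-∘ 1F 1F w       = 2F , refl
  turn-∘ 1F 2F (u , v) = 3F , cong (_, - u) (sym (neg-involutive v))
  turn-∘ 1F 3F (u , v) = 0F , cong (_, v) (sym (neg-involutive u))
  turn-∘ 2F 0F w       = 2F , refl
  turn-∘ 2F 1F (u , v) = 3F , cong (_, - u) (sym (neg-involutive v))
  turn-∘ 2F 2F (u , v) = 0F , cong₂ _,_ (sym (neg-involutive u)) (sym (neg-involutive v))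
  turn-∘ 2F 3F (u , v) = 1F , cong (- v ,_) (sym (neg-involutive u))
  turn-∘ 3F 0F w       = 3F , refl
  turn-∘ 3F 1F (u , v) = 0F , cong (u ,_) (sym (neg-involutive v))
  turn-∘ 3F 2F (u , v) = 1F , cong (- v ,_) (sym (neg-involutive u))
  turn-∘ 3F 3F w       = 2F , refl

  rotate-cellAt : ∀ i F w → ∃[ G ] ∃[ t ] cellAt G (turn t w) ≡ rotate i (cellAt F w)
  rotate-cellAt xAxis 0F w = 0F , 1F , refl
  rotate-cellAt xAxis 1F w = 1F , 3F , refl
  rotate-cellAt xAxis 2F w = 4F , 3F , refl
  rotate-cellAt xAxis 3F w = 5F , 1F , refl
  rotate-cellAt xAxis 4F w = 3F , 0F , refl
  rotate-cellAt xAxis 5F w = 2F , 0F , refl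
  rotate-cellAt yAxis 0F w = 5F , 0F , refl
  rotate-cellAt yAxis 1F w = 4F , 0F , refl
  rotate-cellAt yAxis 2F w = 2F , 1F , refl
  rotate-cellAt yAxis 3F w = 3F , 3F , refl
  rotate-cellAt yAxis 4F w = 0F , 3F , refl
  rotate-cellAt yAxis 5F w = 1F , 1F , refl
  rotate-cellAt zAxis 0F w = 2F , 3F , refl
  rotate-cellAt zAxis 1F w = 3F , 1F , refl
  rotate-cellAt zAxis 2F w = 1F , 0F , refl
  rotate-cellAt zAxis 3F w = 0F , 0F , refl
  rotate-cellAt zAxis 4F w = 4F , 1F , refl
  rotate-cellAt zAxis 5F w = 5F , 3F , refl

  local : Cell → L̄† × L̄†
  local c = proj₁ (proj₂ (locate c))

  infix 4 _∈Orbit_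

  -- Six faces times four quarter turns contain every image of `c` under rotations of the cube,
  -- hence under twists. The 24 descriptions may coincide, for instance at the centre of a face, so
  -- orbits are enumerated with repetition.
  data _∈Orbit_ (d c : Cell) : Set ℓ where
    rotated : ∀ F t → cellAt F (turn t (local c)) ≡ d → d ∈Orbit c

  self-∈Orbit : ∀ c → c ∈Orbit c
  self-∈Orbit c = rotated (proj₁ (locate c)) 0F (proj₂ (proj₂ (locate c)))

  rotate-∈Orbit : ∀ {c d} i → d ∈Orbit c → rotate i d ∈Orbit c
  rotate-∈Orbit {c} i (rotated F t refl)
    with G , s , eq ← rotate-cellAt i F (turn t (local c))
    with r , eq′ ← turn-∘ s t (local c) = rotated G r (trans (cong (cellAt G) eq′) eq)

  orbit : Cell → Fin 24 → Cell
  orbit c g = cellAt (proj₁ (remQuot {6} 4 g)) (turn (proj₂ (remQuot {6} 4 g)) (local c))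

  orbit-∈Orbit : ∀ c g → orbit c g ∈Orbit c
  orbit-∈Orbit c g = rotated _ _ refl

  orbit-surjective : ∀ {c d} → d ∈Orbit c → ∃[ g ] orbit c g ≡ d
  orbit-surjective {c} (rotated F t eq) = combine F t ,
    trans (cong (λ (F , t) → cellAt F (turn t (local c))) (Fin.remQuot-combine F t)) eq

  -- Linked cells and what their colours reveal

  sign : ∀ {a} → AtInfinity a → L̄† → L̄†
  sign plus  w = w
  sign minus w = - w

  -- Linked w c c′ : the cells c and c′ lie on two faces of the same cubie, and
  -- w is the remaining coordinate of the cubie in the right-handed frame
  -- whose first two axes are the outward normals of those faces.
  data Linked (w : L̄†) : Cell → Cell → Set ℓ where
    xy : ∀ {a b c} (e : AtInfinity a) (e′ : AtInfinity b) → c ≡ sign e (sign e′ w) →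
         Linked w (cell ⟨ a , b , c ⟩ xAxis e) (cell ⟨ a , b , c ⟩ yAxis e′)
    yz : ∀ {a b c} (e : AtInfinity b) (e′ : AtInfinity c) → a ≡ sign e (sign e′ w) →
         Linked w (cell ⟨ a , b , c ⟩ yAxis e) (cell ⟨ a , b , c ⟩ zAxis e′)
    zx : ∀ {a b c} (e : AtInfinity c) (e′ : AtInfinity a) → b ≡ sign e (sign e′ w) →
         Linked w (cell ⟨ a , b , c ⟩ zAxis e) (cell ⟨ a , b , c ⟩ xAxis e′)
    yx : ∀ {a b c} (e : AtInfinity b) (e′ : AtInfinity a) → c ≡ sign e (sign e′ (- w)) →
         Linked w (cell ⟨ a , b , c ⟩ yAxis e) (cell ⟨ a , b , c ⟩ xAxis e′)
    zy : ∀ {a b c} (e : AtInfinity c) (e′ : AtInfinity b) → a ≡ sign e (sign e′ (- w)) →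
         Linked w (cell ⟨ a , b , c ⟩ zAxis e) (cell ⟨ a , b , c ⟩ yAxis e′)
    xz : ∀ {a b c} (e : AtInfinity a) (e′ : AtInfinity c) → b ≡ sign e (sign e′ (- w)) →
         Linked w (cell ⟨ a , b , c ⟩ xAxis e) (cell ⟨ a , b , c ⟩ zAxis e′)

  linked-point : ∀ {w c c′} → Linked w c c′ → point c ≡ point c′
  linked-point (xy _ _ _) = refl
  linked-point (yz _ _ _) = refl
  linked-point (zx _ _ _) = refl
  linked-point (yx _ _ _) = refl
  linked-point (zy _ _ _) = refl
  linked-point (xz _ _ _) = refl

  neg-sign-sign : ∀ {a b c w} (e : AtInfinity a) (e′ : AtInfinity b) →
                  c ≡ sign e (sign e′ w) → - c ≡ sign e (sign e′ (- w))
  neg-sign-sign plus  plus  = cong -_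
  neg-sign-sign plus  minus = cong -_
  neg-sign-sign minus plus  = cong -_
  neg-sign-sign minus minus = cong -_

  sign-neg : ∀ {a} (e : AtInfinity a) w → sign e (- w) ≡ sign (negAtInfinity e) w
  sign-neg plus  w = refl
  sign-neg minus w = neg-involutive w

  neg-sign-sign⁻¹ : ∀ {a b c w} (e : AtInfinity a) (e′ : AtInfinity b) →
         c ≡ sign e (sign e′ (- w)) → - c ≡ sign e (sign e′ w)
  neg-sign-sign⁻¹ e e′ eq = trans (neg-sign-sign e e′ eq) (cong (sign e ∘ sign e′) (neg-involutive _))

  flipˡ : ∀ {a b c w} (e : AtInfinity a) (e′ : AtInfinity b) →
          c ≡ sign e (sign e′ (- w)) → c ≡ sign (negAtInfinity e) (sign e′ w)
  flipˡ e plus  eq = trans eq (sign-neg e _)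
  flipˡ e minus eq = trans eq (sign-neg e _)

  flipʳ : ∀ {a b c w} (e : AtInfinity a) (e′ : AtInfinity b) →
          c ≡ sign e (sign e′ (- w)) → c ≡ sign e (sign (negAtInfinity e′) w)
  flipʳ e e′ eq = trans eq (cong (sign e) (sign-neg e′ _))

  involute : ∀ {a b c w} (e : AtInfinity a) (e′ : AtInfinity b) →
             c ≡ sign e (sign e′ w) → c ≡ sign e (sign e′ (- (- w)))
  involute e e′ eq = trans eq (cong (sign e ∘ sign e′) (sym (neg-involutive _)))

  -- Rotations preserve orientation: the outward normals and the right-handed frame move together
  -- with the cubie, so its third coordinate in that frame is unchanged.
  rotate-linked : ∀ {w c c′} i → Linked w c c′ → Linked w (rotate i c) (rotate i c′)
  rotate-linked xAxis (xy e e′ eq) = xz e e′ (neg-sign-sign e e′ eq)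
  rotate-linked xAxis (yz e e′ eq) = zy e (negAtInfinity e′) (flipʳ e e′ (involute e e′ eq))
  rotate-linked xAxis (zx e e′ eq) = yx (negAtInfinity e) e′ (flipˡ e e′ (involute e e′ eq))
  rotate-linked xAxis (yx e e′ eq) = zx e e′ (neg-sign-sign⁻¹ e e′ eq)
  rotate-linked xAxis (zy e e′ eq) = yz (negAtInfinity e) e′ (flipˡ e e′ eq)
  rotate-linked xAxis (xz e e′ eq) = xy e (negAtInfinity e′) (flipʳ e e′ eq)
  rotate-linked yAxis (xy e e′ eq) = zy (negAtInfinity e) e′ (flipˡ e e′ (involute e e′ eq))
  rotate-linked yAxis (yz e e′ eq) = yx e e′ (neg-sign-sign e e′ eq)
  rotate-linked yAxis (zx e e′ eq) = xz e (negAtInfinity e′) (flipʳ e e′ (involute e e′ eq))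
  rotate-linked yAxis (yx e e′ eq) = yz e (negAtInfinity e′) (flipʳ e e′ eq)
  rotate-linked yAxis (zy e e′ eq) = xy e e′ (neg-sign-sign⁻¹ e e′ eq)
  rotate-linked yAxis (xz e e′ eq) = zx (negAtInfinity e) e′ (flipˡ e e′ eq)
  rotate-linked zAxis (xy e e′ eq) = yx e (negAtInfinity e′) (flipʳ e e′ (involute e e′ eq))
  rotate-linked zAxis (yz e e′ eq) = xz (negAtInfinity e) e′ (flipˡ e e′ (involute e e′ eq))
  rotate-linked zAxis (zx e e′ eq) = zy e e′ (neg-sign-sign e e′ eq)
  rotate-linked zAxis (yx e e′ eq) = xy (negAtInfinity e) e′ (flipˡ e e′ eq)
  rotate-linked zAxis (zy e e′ eq) = zx e (negAtInfinity e′) (flipʳ e e′ eq)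
  rotate-linked zAxis (xz e e′ eq) = yz e e′ (neg-sign-sign⁻¹ e e′ eq)

  -- Linked cells share a point, so a twist moves both by the same rotation or moves neither.
  pull-linked : ∀ σ {w c c′} → Linked w c c′ → Linked w (pull σ c) (pull σ c′)
  pull-linked σ {w} {c} {c′} link = caseLayer σ c
    (λ c∈σ → subst₂ (Linked w) (sym (pull-on σ c∈σ)) (sym (pull-on σ (trans (sym c≈c′) c∈σ)))
      (go (suc (toℕ (extraTurns σ))) link))
    (λ c∉σ → subst₂ (Linked w) (sym (pull-off σ c∉σ)) (sym (pull-off σ (c∉σ ∘ trans c≈c′))) link)
    where
    i = axis σ
    c≈c′ : coord i (point c) ≡ coord i (point c′)
    c≈c′ = cong (coord i) (linked-point link)
    go : ∀ m {c c′} → Linked w c c′ →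
         Linked w (iterate (rotate⁻¹ i) c m) (iterate (rotate⁻¹ i) c′ m)
    go zero    link = link
    go (suc m) link = go m (rotate-linked i (rotate-linked i (rotate-linked i link)))

  colour : Cell → Colour
  colour c = faceColour (mark c) (onFace c)

  decode : Colour → Axis × L̄†
  decode red    = xAxis , +∞
  decode blue   = yAxis , +∞
  decode white  = zAxis , +∞
  decode orange = xAxis , -∞
  decode green  = yAxis , -∞
  decode yellow = zAxis , -∞

  decode-faceColour : ∀ {a} i (e : AtInfinity a) → decode (faceColour i e) ≡ (i , a)
  decode-faceColour xAxis plus  = refl
  decode-faceColour yAxis plus  = refl
  decode-faceColour zAxis plus  = refl
  decode-faceColour xAxis minus = refl
  decode-faceColour yAxis minus = refl
  decode-faceColour zAxis minus = refl

  faceColour-injective : ∀ {a b i j} {e : AtInfinity a} {e′ : AtInfinity b} →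
                         faceColour i e ≡ faceColour j e′ → (i , a) ≡ (j , b)
  faceColour-injective {i = i} {j} {e} {e′} eq =
    trans (sym (decode-faceColour i e)) (trans (cong decode eq) (decode-faceColour j e′))

  linked-point-unique : ∀ {w p q i j e e′ u u′} →
    Linked w (cell p i e) (cell p j e′) → Linked w (cell q i u) (cell q j u′) →
    coord i p ≡ coord i q → coord j p ≡ coord j q → p ≡ q
  linked-point-unique (xy e e′ eq) (xy u u′ eq′) refl refl
    rewrite onFace-irrelevant e u | onFace-irrelevant e′ u′ = cong (λ c → ⟨ _ , _ , c ⟩) (trans eq (sym eq′))
  linked-point-unique (yz e e′ eq) (yz u u′ eq′) refl refl
    rewrite onFace-irrelevant e u | onFace-irrelevant e′ u′ = cong (λ a → ⟨ a , _ , _ ⟩) (trans eq (sym eq′))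
  linked-point-unique (zx e e′ eq) (zx u u′ eq′) refl refl
    rewrite onFace-irrelevant e u | onFace-irrelevant e′ u′ = cong (λ b → ⟨ _ , b , _ ⟩) (trans eq (sym eq′))
  linked-point-unique (yx e e′ eq) (yx u u′ eq′) refl refl
    rewrite onFace-irrelevant e u | onFace-irrelevant e′ u′ = cong (λ c → ⟨ _ , _ , c ⟩) (trans eq (sym eq′))
  linked-point-unique (zy e e′ eq) (zy u u′ eq′) refl refl
    rewrite onFace-irrelevant e u | onFace-irrelevant e′ u′ = cong (λ a → ⟨ a , _ , _ ⟩) (trans eq (sym eq′))
  linked-point-unique (xz e e′ eq) (xz u u′ eq′) refl refl
    rewrite onFace-irrelevant e u | onFace-irrelevant e′ u′ = cong (λ b → ⟨ _ , b , _ ⟩) (trans eq (sym eq′))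

  -- Each colour names a face, so two colours fix both marks and two coordinates; `w` then fixes the
  -- third.
  linked-colours-injective : ∀ {w c c′ d d′} → Linked w c c′ → Linked w d d′ →
                             colour c ≡ colour d → colour c′ ≡ colour d′ → c ≡ d
  linked-colours-injective {c = cell p i e} {cell p′ j e′} {cell q k u} {cell q′ l u′} link link′ eq eq′
    with refl ← linked-point link | refl ← linked-point link′
    with same ← faceColour-injective {e = e} {u} eq | same′ ← faceColour-injective {e = e′} {u′} eq′
    with refl ← cong proj₁ same | refl ← cong proj₁ same′ =
    cell-≡ (linked-point-unique link link′ (cong proj₂ same) (cong proj₂ same′))

  -- Linked cells of a cubie that every twist of the layer moves.
  probe probe′ : Axis → L̄† → Cell
  probe  xAxis α = cell ⟨ α , +∞ , +∞ ⟩ yAxis plus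
  probe  yAxis α = cell ⟨ +∞ , α , +∞ ⟩ zAxis plus
  probe  zAxis α = cell ⟨ +∞ , +∞ , α ⟩ xAxis plus
  probe′ xAxis α = cell ⟨ α , +∞ , +∞ ⟩ zAxis plus
  probe′ yAxis α = cell ⟨ +∞ , α , +∞ ⟩ xAxis plus
  probe′ zAxis α = cell ⟨ +∞ , +∞ , α ⟩ yAxis plus

  probes-linked : ∀ i α → Linked α (probe i α) (probe′ i α)
  probes-linked xAxis α = yz plus plus refl
  probes-linked yAxis α = zx plus plus refl
  probes-linked zAxis α = xy plus plus refl

  probe-coord : ∀ i α → coord i (point (probe i α)) ≡ α
  probe-coord xAxis α = refl
  probe-coord yAxis α = refl
  probe-coord zAxis α = refl

  -- In the plane of the layer the probe sits at the corner with both coordinates `+∞`, whose four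
  -- images under quarter turns are distinct whatever `α` is.
  rotate-probe : ∀ i α (n : Fin 3) → iterate (rotate⁻¹ i) (probe i α) (suc (toℕ n)) ≢ probe i α
  rotate-probe xAxis α 0F ()
  rotate-probe xAxis α 1F ()
  rotate-probe xAxis α 2F ()
  rotate-probe yAxis α 0F ()
  rotate-probe yAxis α 1F ()
  rotate-probe yAxis α 2F ()
  rotate-probe zAxis α 0F ()
  rotate-probe zAxis α 1F ()
  rotate-probe zAxis α 2F ()

  pull-probe : ∀ τ → pull τ (probe (axis τ) (layer τ)) ≢ probe (axis τ) (layer τ)
  pull-probe τ eq = rotate-probe (axis τ) (layer τ) (extraTurns τ)
    (trans (sym (pull-on τ (probe-coord (axis τ) (layer τ)))) eq)

-- Origins of cells along a run

module Runs {ℓ} (em : ExcludedMiddle ℓ) (L : Set ℓ) (σ : EdgedCube.BasicSequence em L) where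
  open EdgedCube em L
  open Geometry em L
  open BasicTwist
  open Ordinal (length σ) using (Carrier; below)
  open Stages (length σ)
  open StageProperties (length σ)
  open Classical em

  -- Origin s c d : at stage s the cell c carries what the cell d carried initially.
  data Origin : Stage → Cell → Cell → Set ℓ where
    start : ∀ {s c} → IsZero s → Origin s c c
    step  : ∀ {s c d ξ} → IsSuccessorOf ξ s → Origin [ ξ ] (pull (twist σ ξ) c) d → Origin s c d
    limit : ∀ {s c d β} → IsLimit s → [ β ] <ₛ s →
            (∀ η → below β η → [ η ] <ₛ s → Origin [ η ] c d) → Origin s c d

  Tracked : Set ℓ
  Tracked = ∀ s c → ∃[ d ] Origin s c d

  beyond-both : ∀ {s β γ} → IsLimit s → [ β ] <ₛ s → [ γ ] <ₛ s →
                ∃[ η ] [ η ] <ₛ s × below β η × below γ η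
  beyond-both lim β<s γ<s =
    eventually-witness lim (eventually-× (eventually-beyond β<s) (eventually-beyond γ<s))

  -- Two origins at the same stage are traced back through the same pulls; at a limit, an index
  -- beyond both bounds is used. The instances are equality, inequality, membership of an orbit, and
  -- linkage.
  origin-related : ∀ {q} (R : Rel Cell q) →
                   (∀ τ {c c′} → R c c′ → R (pull τ c) (pull τ c′)) →
                   ∀ {s c c′ d d′} → Origin s c d → Origin s c′ d′ → R c c′ → R d d′
  origin-related R pull-R (start _)         (start _)                r = r
  origin-related R pull-R (start s≡0)       (step (ξ<s , _) _)       r = contradiction ξ<s (s≡0 _)
  origin-related R pull-R (start s≡0)       (limit (s≢0 , _) _ _)    r = contradiction s≡0 s≢0
  origin-related R pull-R (step (ξ<s , _) _) (start s≡0)             r = contradiction ξ<s (s≡0 _)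
  origin-related R pull-R (step {ξ = ξ} ξ+ o) (step ζ+ o′)         r
    with refl ← successor-unique ξ+ ζ+ = origin-related R pull-R o o′ (pull-R (twist σ ξ) r)
  origin-related R pull-R (step ξ+ _)       (limit (_ , s≢+) _ _)    r = contradiction ξ+ (s≢+ _)
  origin-related R pull-R (limit (s≢0 , _) _ _) (start s≡0)          r = contradiction s≡0 s≢0
  origin-related R pull-R (limit (_ , s≢+) _ _) (step ξ+ _)          r = contradiction ξ+ (s≢+ _)
  origin-related R pull-R (limit lim β<s o) (limit _ γ<s o′)         r
    with η , η<s , β<η , γ<η ← beyond-both lim β<s γ<s =
    origin-related R pull-R (o η β<η η<s) (o′ η γ<η η<s) r

  origin-functional : ∀ {s c d d′} → Origin s c d → Origin s c d′ → d ≡ d′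
  origin-functional o o′ = origin-related _≡_ (λ τ → cong (pull τ)) o o′ refl

  origin-injective : ∀ {s c c′ d} → Origin s c d → Origin s c′ d → c ≡ c′
  origin-injective {c = c} {c′} o o′ with em {P = c ≡ c′}
  ... | yes c≡c′ = c≡c′
  -- Inequality is itself preserved by pulls, since they are injective.
  ... | no  c≢c′ = contradiction refl
    (origin-related _≢_ (λ τ c≢c′ → c≢c′ ∘ pull-injective τ) o o′ c≢c′)

  origin-∈Orbit : ∀ {s c d e} → Origin s c d → c ∈Orbit e → d ∈Orbit e
  origin-∈Orbit {e = e} o =
    origin-related (λ c _ → c ∈Orbit e) (λ τ → pull-preserves (_∈Orbit e) rotate-∈Orbit τ) o o

  origin-linked : ∀ {s c c′ d d′ w} → Origin s c d → Origin s c′ d′ → Linked w c c′ → Linked w d d′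
  origin-linked = origin-related (Linked _) (λ τ → pull-linked τ)

  origin-limit⁻¹ : ∀ {s c d} → IsLimit s → Origin s c d → Eventually s (λ η → Origin [ η ] c d)
  origin-limit⁻¹ (s≢0 , _) (start s≡0)     = contradiction s≡0 s≢0
  origin-limit⁻¹ (_ , s≢+) (step ξ+ _)     = contradiction ξ+ (s≢+ _)
  origin-limit⁻¹ _         (limit _ β<s o) = _ , β<s , o

  module _ {a} {X : Set a} {f₀ : Labelling X} where

    origin-run : ∀ {f} → IsRun σ f₀ f → ∀ {s c d} → Origin s c d → f s c ≡ f₀ d
    origin-run run (start s≡0)       = IsRun.start run _ s≡0 _
    origin-run run {s} {c} (step {ξ = ξ} ξ+ o) = trans (IsRun.successor run ξ s ξ+ c) (origin-run run o)
    origin-run run (limit lim β<s o) =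
      IsRun.limit run _ lim _ _ (_ , β<s , λ η β<η η<s → origin-run run (o η β<η η<s))

    module _ (tracked : Tracked) where

      tracked-run : IsRun σ f₀ (λ s c → f₀ (proj₁ (tracked s c)))
      tracked-run = record
        { start     = λ s s≡0 c → cong f₀ (origin-functional (traced s c) (start s≡0))
        ; successor = λ ξ s ξ+ c → cong f₀ (origin-functional (traced s c) (step ξ+ (traced [ ξ ] (pull (twist σ ξ) c))))
        ; limit     = λ s lim c v ev →
            let η , η<s , o , f≡v = eventually-witness lim (eventually-× (origin-limit⁻¹ lim (traced s c)) ev)
            in trans (cong f₀ (origin-functional o (traced [ η ] c))) f≡v
        ; limit-NaC = λ s lim c none → contradiction
            (_ , eventually-map (λ η η<s o → cong f₀ (origin-functional (traced [ η ] c) o))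
                   (origin-limit⁻¹ lim (traced s c)))
            none
        }
        where
        traced : ∀ s c → Origin s c (proj₁ (tracked s c))
        traced s c = proj₂ (tracked s c)

      -- The terminal labelling is `f₀` composed with the origin map at `⊤⁺`. This replaces
      -- transfinite runs by functions on cells when sequences are concatenated.
      terminal⇔ : ∀ {g} → Terminal σ f₀ g ⇔ (∀ c → f₀ (proj₁ (tracked ⊤⁺ c)) ≡ g c)
      terminal⇔ = mk⇔
        (λ (f , run , f≗g) c → trans (sym (origin-run run (proj₂ (tracked ⊤⁺ c)))) (f≗g c))
        (λ eq → _ , tracked-run , eq)

      tracked⇒convergent : Legal f₀ → ConvergentOver σ f₀
      tracked⇒convergent legal = _ , (_ , tracked-run , λ _ → refl) , λ c → legal _

  -- Persistence of NaC entries

  someNothing? : ∀ {a n} {X : Set a} (v : Fin n → Maybe X) → Dec (∃[ g ] v g ≡ nothing)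
  someNothing? v = Fin.any? λ g → nothing? (v g)
    where
    nothing? : ∀ v → Dec (v ≡ nothing)
    nothing? nothing  = yes refl
    nothing? (just _) = no λ ()

  module LegalRun {a} {X : Set a} (em′ : ExcludedMiddle (ℓ ⊔ a)) {f₀ : Labelling X}
                  {f : Stage → Labelling X} (run : IsRun σ f₀ f) where
    open IsRun run renaming (limit to f-limit)

    eventually-constant : ∀ {s c} → IsLimit s → f s c ≢ nothing → EventuallyAt σ f₀ f s c (f s c)
    eventually-constant {s} {c} lim legal with em′ {P = ∃[ v ] EventuallyAt σ f₀ f s c v}
    ... | yes (v , ev) = subst (EventuallyAt σ f₀ f s c) (sym (f-limit s lim c v ev)) ev
    ... | no  none     = contradiction (limit-NaC s lim c none) legal

    nothing-or-eventually-constant : ∀ {s n} → IsLimit s → (cells : Fin n → Cell) →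
      (∃[ g ] f s (cells g) ≡ nothing) ⊎ Eventually s (λ η → ∀ g → f [ η ] (cells g) ≡ f s (cells g))
    nothing-or-eventually-constant {s} lim cells with someNothing? (f s ∘ cells)
    ... | yes some  = inj₁ some
    ... | no  legal = inj₂ (eventually-all lim λ g → eventually-constant lim λ eq → legal (g , eq))

    -- A twist only moves the entry within its orbit. At a limit, if no entry of the orbit is
    -- visibly NaC, all 24 descriptions have their limit values from a common index on, and the
    -- induction hypothesis at such an index supplies a NaC.
    nothing-persists : ∀ {ξ c} → f [ ξ ] c ≡ nothing → ∀ t → [ ξ ] <ₛ t →
                       ∃[ d ] d ∈Orbit c × f t d ≡ nothing
    nothing-persists {ξ} {c} fξc≡nothing = stage-induction _ go
      where
      Persists : Stage → Set _
      Persists t = ∃[ d ] d ∈Orbit c × f t d ≡ nothing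

      go : ∀ t → (∀ ζ → [ ζ ] <ₛ t → [ ξ ] <ₛ [ ζ ] → Persists [ ζ ]) → [ ξ ] <ₛ t → Persists t
      go t rec ξ<t with kind t
      ... | zero t≡0       = contradiction ξ<t (t≡0 ξ)
      ... | successor ζ ζ+ = let d , d∈c , eq = at-ζ in
          push τ d , push-preserves (_∈Orbit c) rotate-∈Orbit τ d∈c ,
          trans (IsRun.successor run ζ t ζ+ (push τ d)) (trans (cong (f [ ζ ]) (pull-push τ d)) eq)
        where
        τ = twist σ ζ
        at-ζ : Persists [ ζ ]
        at-ζ with below-successor ζ+ ξ<t
        ... | inj₁ refl = c , self-∈Orbit c , fξc≡nothing
        ... | inj₂ ξ<ζ  = rec ζ (proj₁ ζ+) [ ξ<ζ ]
      ... | limit lim = at-limit (nothing-or-eventually-constant lim (orbit c))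
        where
        at-limit : (∃[ g ] f t (orbit c g) ≡ nothing) ⊎
                   Eventually t (λ η → ∀ g → f [ η ] (orbit c g) ≡ f t (orbit c g)) → Persists t
        at-limit (inj₁ (g , eq)) = orbit c g , orbit-∈Orbit c g , eq
        at-limit (inj₂ constant) =
          let η , η<t , ξ<η , constant-η = eventually-witness lim (eventually-× (eventually-beyond ξ<t) constant)
              d , d∈c , eq = rec η η<t [ ξ<η ]
              g , g↦d      = orbit-surjective d∈c
          in orbit c g , orbit-∈Orbit c g ,
             trans (sym (constant-η g)) (trans (cong (f [ η ]) g↦d) eq)

    legal-throughout : Legal (f ⊤⁺) → ∀ s → Legal (f s)
    legal-throughout legal ⊤⁺    c      = legal c
    legal-throughout legal [ ξ ] c eq
      with d , _ , eq′ ← nothing-persists eq ⊤⁺ [ ξ ]<⊤⁺ = legal d eq′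

  -- Over the identity labelling the label of a cell names its origin, and legality at every stage
  -- supplies that label.
  universally-convergent⇒tracked : UniversallyConvergent σ → Tracked
  universally-convergent⇒tracked (g , (f , run , f≗g) , legal) s c
    with f s c in eq | legal-throughout (λ c eq → legal c (trans (sym (f≗g c)) eq)) s c
    where open LegalRun em run
  ... | nothing | f≢nothing = contradiction refl f≢nothing
  ... | just d  | _         = d , stage-induction Traced go s c d eq
    where
    open LegalRun em run
    Traced : Stage → Set ℓ
    Traced s = ∀ c d → f s c ≡ just d → Origin s c d
    go : ∀ s → (∀ ξ → [ ξ ] <ₛ s → Traced [ ξ ]) → Traced s
    go s rec c d eq with kind s
    ... | zero s≡0 with refl ← trans (sym (IsRun.start run s s≡0 c)) eq = start s≡0
    ... | successor ξ ξ+ = step ξ+ (rec ξ (proj₁ ξ+) (pull (twist σ ξ) c) d (trans (sym (IsRun.successor run ξ s ξ+ c)) eq))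
    ... | limit lim
        with β , β<s , constant ← eventually-constant {s} {c} lim (λ eq′ → contradiction (trans (sym eq) eq′) λ ()) =
        limit lim β<s λ η β<η η<s → rec η η<s c d (trans (constant η β<η η<s) eq)

  -- Every twist beyond `β` fixes the cell, so induction on stages carries the origin from `η₀` up
  -- to `s`. As `η₀` is strictly above `β`, the twist at `η₀` itself is covered.
  origin-constant : ∀ {s c d β η₀} → (∀ η → below β η → [ η ] <ₛ s → ¬ OnLayer (twist σ η) c) →
                    below β η₀ → [ η₀ ] <ₛ s → Origin [ η₀ ] c d → Origin s c d
  origin-constant {s} {c} {d} {β} {η₀} untouched β<η₀ η₀<s o = stage-induction Constant go s η₀<s (λ _ ζ<s → ζ<s)
    where
    Constant : Stage → Set ℓ
    Constant t = [ η₀ ] <ₛ t → (∀ ζ → [ ζ ] <ₛ t → [ ζ ] <ₛ s) → Origin t c d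
    go : ∀ t → (∀ ξ → [ ξ ] <ₛ t → Constant [ ξ ]) → Constant t
    go t rec η₀<t t≤s with kind t
    ... | zero t≡0       = contradiction η₀<t (t≡0 η₀)
    ... | limit lim      = limit lim η₀<t λ η η₀<η η<t →
        rec η η<t [ η₀<η ] (λ { ζ [ ζ<η ] → t≤s ζ (<ₛ-trans ζ<η η<t) })
    ... | successor ξ ξ+ = step ξ+ (subst (λ c′ → Origin [ ξ ] c′ d) (sym (pull-off (twist σ ξ) off)) at-ξ)
      where
      at-ξ : Origin [ ξ ] c d
      at-ξ with below-successor ξ+ η₀<t
      ... | inj₁ refl = o
      ... | inj₂ η₀<ξ = rec ξ (proj₁ ξ+) [ η₀<ξ ] (λ { ζ [ ζ<ξ ] → t≤s ζ (<ₛ-trans ζ<ξ (proj₁ ξ+)) })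
      off : ¬ OnLayer (twist σ ξ) c
      off with below-successor ξ+ η₀<t
      ... | inj₁ refl = untouched ξ β<η₀ η₀<s
      ... | inj₂ η₀<ξ = untouched ξ (below-trans β<η₀ η₀<ξ) (t≤s ξ (proj₁ ξ+))

  -- Legal runs over the solved configuration

  module _ {f : Stage → Configuration} (run : IsRun σ solved f) (legal : ∀ s → Legal (f s)) where
    open LegalRun em run

    TotalAt : Stage → Set ℓ
    TotalAt s = ∀ c → ∃[ d ] Origin s c d

    -- The two colours on a linked pair of cells determine where the pair came from.
    twist-visible : ∀ {η} τ → TotalAt [ η ] →
                    let c = probe (axis τ) (layer τ) ; c′ = probe′ (axis τ) (layer τ) in
                    f [ η ] (pull τ c) ≡ f [ η ] c → ¬ (f [ η ] (pull τ c′) ≡ f [ η ] c′)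
    twist-visible {η} τ total eq eq′
      with d , o ← total (probe (axis τ) (layer τ)) | d′ , o′ ← total (probe′ (axis τ) (layer τ))
         | e , p ← total (pull τ (probe (axis τ) (layer τ)))
         | e′ , p′ ← total (pull τ (probe′ (axis τ) (layer τ))) =
      pull-probe τ (origin-injective p (subst (Origin _ _) (sym e≡d) o))
      where
      link = probes-linked (axis τ) (layer τ)
      e≡d : e ≡ d
      e≡d = linked-colours-injective (origin-linked p p′ (pull-linked τ link)) (origin-linked o o′ link)
        (just-injective (trans (sym (origin-run run p)) (trans eq (origin-run run o))))
        (just-injective (trans (sym (origin-run run p′)) (trans eq′ (origin-run run o′))))

    -- The colours of both probe cells are eventually constant, so a later twist of the layer would
    -- leave both unchanged, which `twist-visible` forbids.
    eventually-untwisted : ∀ {s} → IsLimit s → (∀ η → [ η ] <ₛ s → TotalAt [ η ]) → ∀ i α →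
                           Eventually s (λ η → ¬ (axis (twist σ η) ≡ i × layer (twist σ η) ≡ α))
    eventually-untwisted {s} lim total i α
      with β , β<s , constant ← eventually-× (eventually-constant {s} {probe i α} lim (legal s _))
                                             (eventually-constant {s} {probe′ i α} lim (legal s _)) =
      β , β<s , untwisted
      where
      untwisted : ∀ η → below β η → [ η ] <ₛ s → ¬ (axis (twist σ η) ≡ i × layer (twist σ η) ≡ α)
      -- The stage `ζ` right after `η` is still below `s`, so the colours just before and just after
      -- the twist both equal those at `s`.
      untwisted η β<η η<s (refl , refl) with ζ , ζ<s , η+ ← next lim η<s =
        twist-visible (twist σ η) (total η η<s) (unchanged (proj₁ η-ζ) (proj₁ ζ-c)) (unchanged (proj₂ η-ζ) (proj₂ ζ-c))
        where
        η-ζ = constant η β<η η<s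
        ζ-c = constant ζ (below-trans β<η ([<]-injective below (proj₁ η+))) ζ<s
        unchanged : ∀ {c} → f [ η ] c ≡ f s c → f [ ζ ] c ≡ f s c → f [ η ] (pull (twist σ η) c) ≡ f [ η ] c
        unchanged {c} eq eq′ = trans (sym (IsRun.successor run η [ ζ ] η+ c)) (trans eq′ (sym eq))

    solved-tracked : Tracked
    solved-tracked = stage-induction TotalAt go
      where
      at-limit : ∀ {s} → IsLimit s → (∀ ξ → [ ξ ] <ₛ s → TotalAt [ ξ ]) → TotalAt s
      at-limit {s} lim rec c =
        -- The three layers through `c` have a common bound, beyond which `c` stays in place.
        let β , β<s , untwisted = eventually-× (untwistedAt xAxis) (eventually-× (untwistedAt yAxis) (untwistedAt zAxis))
            η₀ , β<η₀ , η₀<s    = limit-unbounded lim β<s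
            d , o               = rec η₀ η₀<s c
        in d , origin-constant (λ η β<η η<s → off η (untwisted η β<η η<s)) β<η₀ η₀<s o
        where
        Untwisted : Axis → Carrier → Set ℓ
        Untwisted i η = ¬ (axis (twist σ η) ≡ i × layer (twist σ η) ≡ coord i (point c))
        untwistedAt : ∀ i → Eventually s (Untwisted i)
        untwistedAt i = eventually-untwisted lim rec i (coord i (point c))
        off : ∀ η → Untwisted xAxis η × Untwisted yAxis η × Untwisted zAxis η → ¬ OnLayer (twist σ η) c
        off η (x , y , z) on with axis (twist σ η)
        ... | xAxis = x (refl , sym on)
        ... | yAxis = y (refl , sym on)
        ... | zAxis = z (refl , sym on)
      go : ∀ s → (∀ ξ → [ ξ ] <ₛ s → TotalAt [ ξ ]) → TotalAt s
      go s rec c with kind s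
      ... | zero s≡0       = c , start s≡0
      ... | successor ξ ξ+ = let d , o = rec ξ (proj₁ ξ+) (pull (twist σ ξ) c) in d , step ξ+ o
      ... | limit lim      = at-limit lim rec c

  convergent-over-solved⇒tracked : ConvergentOverSolved σ → Tracked
  convergent-over-solved⇒tracked (g , (f , run , f≗g) , legal) =
    solved-tracked run (legal-throughout (λ c eq → legal c (trans (sym (f≗g c)) eq)))
    where open LegalRun em run

-- Concatenation and powers

∅ₒ : ∀ {ℓ} → Ordinal ℓ
∅ₒ = record
  { Carrier            = ⊥
  ; below              = λ ()
  ; isStrictTotalOrder = record
    { isStrictPartialOrder = record
      { isEquivalence = isEquivalence
      ; irrefl        = λ { {()} }
      ; trans         = λ { {()} }
      ; <-resp-≈      = (λ { {()} }) , λ { {()} }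
      }
    ; compare            = λ ()
    }
  ; wellFounded        = λ ()
  }

module Sequences {ℓ} (em : ExcludedMiddle ℓ) (L : Set ℓ) where
  open EdgedCube em L
  open Geometry em L
  open Runs em L

  module _ (τ σ : BasicSequence) where
    private
      module σ = Stages (length σ)
      module τ = Stages (length τ)
      module τσ = Stages (length (τ ⊙ σ))

    -- Stages correspond by the moves made before them: the end of `σ` matches the first stage of
    -- `τ`, which is `⊤⁺` if `τ` is empty and some `[ inj₂ ζ ]` otherwise.
    record FirstPart (s : σ.Stage) (u : τσ.Stage) : Set ℓ where
      field
        into : ∀ {ξ} → [ ξ ] σ.<ₛ s → [ inj₁ ξ ] τσ.<ₛ u
        from : ∀ {ξ} → [ inj₁ ξ ] τσ.<ₛ u → [ ξ ] σ.<ₛ s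
        none : ∀ {ζ} → ¬ [ inj₂ ζ ] τσ.<ₛ u

    record SecondPart (t : τ.Stage) (u : τσ.Stage) : Set ℓ where
      field
        into : ∀ {ζ} → [ ζ ] τ.<ₛ t → [ inj₂ ζ ] τσ.<ₛ u
        from : ∀ {ζ} → [ inj₂ ζ ] τσ.<ₛ u → [ ζ ] τ.<ₛ t
        all  : ∀ {ξ} → [ inj₁ ξ ] τσ.<ₛ u

    firstPart : ∀ ξ → FirstPart [ ξ ] [ inj₁ ξ ]
    firstPart ξ = record { into = λ { [ p ] → [ ₁∼₁ p ] } ; from = λ { [ ₁∼₁ p ] → [ p ] } ; none = λ { [ () ] } }

    secondPart : ∀ ζ → SecondPart [ ζ ] [ inj₂ ζ ]
    secondPart ζ = record { into = λ { [ p ] → [ ₂∼₂ p ] } ; from = λ { [ ₂∼₂ p ] → [ p ] } ; all = [ ₁∼₂ ] }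

    secondPart-⊤ : SecondPart ⊤⁺ ⊤⁺
    secondPart-⊤ = record { into = λ _ → [ _ ]<⊤⁺ ; from = λ _ → [ _ ]<⊤⁺ ; all = [ _ ]<⊤⁺ }

    origin-first : ∀ {s u c d} → FirstPart s u → Origin σ s c d → Origin (τ ⊙ σ) u c d
    origin-first part (start s≡0) = start λ { (inj₁ ξ) p → s≡0 ξ (from p) ; (inj₂ ζ) p → none p }
      where open FirstPart part
    origin-first part (step {ξ = ξ} (ξ<s , last) o) = step
      (into ξ<s , λ { (inj₁ ζ) (₁∼₁ ξ<ζ) p → last ζ ξ<ζ (from p) ; (inj₂ ζ) _ p → none p })
      (origin-first (firstPart ξ) o)
      where open FirstPart part
    origin-first part (limit (s≢0 , s≢+) β<s o) = limit
      ( (λ u≡0 → s≢0 λ ξ p → u≡0 (inj₁ ξ) (into p))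
      , λ { (inj₁ ξ) (p , last) → s≢+ ξ (from p , λ ζ ξ<ζ q → last (inj₁ ζ) (₁∼₁ ξ<ζ) (into q))
          ; (inj₂ ζ) (p , _)    → none p } )
      (into β<s)
      λ { (inj₁ η) (₁∼₁ β<η) p → origin-first (firstPart η) (o η β<η (from p)) ; (inj₂ η) _ p → contradiction p none }
      where open FirstPart part

    origin-second : ∀ {t u c d e} → SecondPart t u → Origin τ t c d → Origin σ ⊤⁺ d e → Origin (τ ⊙ σ) u c e
    -- No move of `τ` has been made yet, so `u` corresponds to the terminal stage of `σ`.
    origin-second part (start t≡0) o′ = origin-first
      (record { into = λ _ → all ; from = λ _ → [ _ ]<⊤⁺ ; none = λ p → t≡0 _ (from p) }) o′
      where open SecondPart part
    origin-second part (step {ξ = ζ} (ζ<t , last) o) o′ = step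
      (into ζ<t , λ { (inj₂ ξ) (₂∼₂ ζ<ξ) p → last ξ ζ<ξ (from p) })
      (origin-second (secondPart ζ) o o′)
      where open SecondPart part
    origin-second part (limit (t≢0 , t≢+) β<t o) o′ = limit
      ( (λ u≡0 → t≢0 λ ζ p → u≡0 (inj₂ ζ) (into p))
      -- The stage cannot directly follow a move of `σ`, since some move of `τ` precedes it.
      , λ { (inj₁ ξ) (_ , last) → t≢0 λ ζ p → last (inj₂ ζ) ₁∼₂ (into p)
          ; (inj₂ ζ) (p , last) → t≢+ ζ (from p , λ ξ ζ<ξ q → last (inj₂ ξ) (₂∼₂ ζ<ξ) (into q)) } )
      (into β<t)
      λ { (inj₂ η) (₂∼₂ β<η) p → origin-second (secondPart η) (o η β<η (from p)) o′ }
      where open SecondPart part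

  tracked-⊙ : ∀ {τ σ} → Tracked τ → Tracked σ → Tracked (τ ⊙ σ)
  tracked-⊙ {τ} {σ} u t [ inj₁ ξ ] c = let d , o = t [ ξ ] c in d , origin-first τ σ (firstPart τ σ ξ) o
  tracked-⊙ {τ} {σ} u t [ inj₂ ζ ] c =
    let d , o = u [ ζ ] c ; e , o′ = t ⊤⁺ d in e , origin-second τ σ (secondPart τ σ ζ) o o′
  tracked-⊙ {τ} {σ} u t ⊤⁺ c =
    let d , o = u ⊤⁺ c ; e , o′ = t ⊤⁺ d in e , origin-second τ σ (secondPart-⊤ τ σ) o o′

  -- Labellings are pulled back along this map, so the order reverses: for `τ ⊙ σ` it computes to
  -- the map of `σ` after that of `τ`, whence `refl` in the monoid laws.
  source : ∀ {σ} → Tracked σ → Cell → Cell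
  source t c = proj₁ (t ⊤⁺ c)

  source-injective : ∀ {σ} (t : Tracked σ) → Injective _≡_ _≡_ (source t)
  source-injective {σ} t {c} {c′} eq =
    origin-injective σ (proj₂ (t ⊤⁺ c)) (subst (Origin σ ⊤⁺ c′) (sym eq) (proj₂ (t ⊤⁺ c′)))

  source-∈Orbit : ∀ {σ} (t : Tracked σ) {c d} → c ∈Orbit d → source t c ∈Orbit d
  source-∈Orbit {σ} t {c} = origin-∈Orbit σ (proj₂ (t ⊤⁺ c))

  same-source⇒∼ : ∀ {σ τ} (t : Tracked σ) (u : Tracked τ) → (∀ c → source t c ≡ source u c) → σ ∼ τ
  same-source⇒∼ {σ} {τ} t u eq f g = mk⇔
    (λ T → Equivalence.from (terminal⇔ τ u) λ c → trans (cong f (sym (eq c))) (Equivalence.to (terminal⇔ σ t) T c))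
    (λ T → Equivalence.from (terminal⇔ σ t) λ c → trans (cong f (eq c)) (Equivalence.to (terminal⇔ τ u) T c))

  terminal-⊙ : ∀ {τ σ} → Tracked τ → Tracked σ → ∀ {f g : Configuration} →
               Terminal (τ ⊙ σ) f g ⇔ (∃[ m ] Terminal σ f m × Terminal τ m g)
  terminal-⊙ {τ} {σ} u t {f} {g} = mk⇔
    (λ T → f ∘ source t , Equivalence.from (terminal⇔ σ t) (λ _ → refl) ,
           Equivalence.from (terminal⇔ τ u) (Equivalence.to (terminal⇔ (τ ⊙ σ) (tracked-⊙ u t)) T))
    (λ (m , T , U) → Equivalence.from (terminal⇔ (τ ⊙ σ) (tracked-⊙ u t)) λ c →
      trans (Equivalence.to (terminal⇔ σ t) T (source u c)) (Equivalence.to (terminal⇔ τ u) U c))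

  ⊙-cong : ∀ {τ τ′ σ σ′} → Tracked τ → Tracked τ′ → Tracked σ → Tracked σ′ →
           τ ∼ τ′ → σ ∼ σ′ → τ ⊙ σ ∼ τ′ ⊙ σ′
  ⊙-cong u u′ t t′ τ∼τ′ σ∼σ′ f g = mk⇔
    (λ T → let m , T₁ , T₂ = Equivalence.to (terminal-⊙ u t) T in
      Equivalence.from (terminal-⊙ u′ t′) (m , Equivalence.to (σ∼σ′ f m) T₁ , Equivalence.to (τ∼τ′ m g) T₂))
    (λ T → let m , T₁ , T₂ = Equivalence.to (terminal-⊙ u′ t′) T in
      Equivalence.from (terminal-⊙ u t) (m , Equivalence.from (σ∼σ′ f m) T₁ , Equivalence.from (τ∼τ′ m g) T₂))

  empty : BasicSequence
  empty = record { length = ∅ₒ ; twist = λ () }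

  empty-tracked : Tracked empty
  empty-tracked ⊤⁺ c = c , start λ ()

  power : BasicSequence → ℕ → BasicSequence
  power σ zero    = empty
  power σ (suc n) = power σ n ⊙ σ

  power-tracked : ∀ {σ} → Tracked σ → ∀ n → Tracked (power σ n)
  power-tracked t zero    = empty-tracked
  power-tracked t (suc n) = tracked-⊙ (power-tracked t n) t

  power-source : ∀ {σ} (t : Tracked σ) n c → source (power-tracked t n) c ≡ fold c (source t) n
  power-source t zero    c = refl
  power-source t (suc n) c = cong (source t) (power-source t n c)

  power-cong : ∀ {σ τ} → Tracked σ → Tracked τ → σ ∼ τ → ∀ n → power σ n ∼ power τ n
  power-cong t u σ∼τ zero    f g = ⇔-id _
  power-cong t u σ∼τ (suc n) = ⊙-cong (power-tracked t n) (power-tracked u n) t u (power-cong t u σ∼τ n) σ∼τ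

  module _ (σ : BasicSequence) where
    open Ordinal

    power-embed : ∀ n → Carrier (length (power σ n)) → Fin n × Carrier (length σ)
    power-embed (suc n) (inj₁ ξ) = zero , ξ
    power-embed (suc n) (inj₂ x) = let i , ξ = power-embed n x in suc i , ξ

    power-embed-monotone : ∀ n {x y} → below (length (power σ n)) x y →
                           below (length σ ·ₒ finite n) (power-embed n x) (power-embed n y)
    power-embed-monotone (suc n) (₁∼₁ ξ<ζ) = inj₂ (refl , ξ<ζ)
    power-embed-monotone (suc n) ₁∼₂       = inj₁ z<s
    power-embed-monotone (suc n) (₂∼₂ x<y) with power-embed-monotone n x<y
    ... | inj₁ i<j           = inj₁ (s<s i<j)
    ... | inj₂ (i≡j , ξ<ζ)   = inj₂ (cong suc i≡j , ξ<ζ)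

    power-embed-surjective : ∀ n y → ∃[ x ] power-embed n x ≡ y
    power-embed-surjective (suc n) (zero  , ξ) = inj₁ ξ , refl
    power-embed-surjective (suc n) (suc i , ξ) with x , refl ← power-embed-surjective n (i , ξ) = inj₂ x , refl

    -- The embedding is onto, so initiality is immediate. It records the number of the copy as the
    -- more significant component.
    power-length : ∀ n → length (power σ n) ≤ₒ length σ ·ₒ finite n
    power-length n = record
      { embed     = power-embed n
      ; monotone  = power-embed-monotone n
      ; isInitial = λ _ → power-embed-surjective n _
      }

  fold-∈Orbit : ∀ {σ} (t : Tracked σ) {c} m → fold c (source t) m ∈Orbit c
  fold-∈Orbit t {c} zero    = self-∈Orbit c
  fold-∈Orbit t     (suc m) = source-∈Orbit t (fold-∈Orbit t m)

  source-period : ∀ {σ} (t : Tracked σ) c → fold c (source t) (suc (exponent 24)) ≡ c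
  source-period t c = fold-exponent (source-injective t) (orbit c) λ m → orbit-surjective (fold-∈Orbit t m)

  module _ {P : BasicSequence → Set ℓ} (P⇔tracked : ∀ σ → P σ ⇔ Tracked σ) where
    private
      tracked : ∀ {σ} → P σ → Tracked σ
      tracked {σ} = Equivalence.to (P⇔tracked σ)
      untracked : ∀ {σ} → Tracked σ → P σ
      untracked {σ} = Equivalence.from (P⇔tracked σ)

    -- Only trackedness matters, so one construction serves both notions of convergence, with the
    -- same operations on the underlying sequences.
    groupModulo∼ : GroupModulo∼ P
    groupModulo∼ = record
      { closed  = λ p q → untracked (tracked-⊙ (tracked p) (tracked q))
      ; ε       = empty , untracked empty-tracked
      -- The iterate `suc (exponent 24)` of every source map is the identity, so one application
      -- fewer gives an inverse. A uniform exponent lets inversion respect `∼`.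
      ; _⁻¹     = λ (σ , p) → power σ (exponent 24) , untracked (power-tracked (tracked p) (exponent 24))
      ; isGroup = record
        { isMonoid = record
          { isSemigroup = record
            { isMagma = record
              { isEquivalence = record
                { refl  = λ f g → ⇔-id _
                ; sym   = λ σ∼τ f g → ⇔-sym (σ∼τ f g)
                ; trans = λ σ∼τ τ∼υ f g → τ∼υ f g ⇔-∘ σ∼τ f g
                }
              ; ∙-cong = λ {(_ , p) (_ , p′) (_ , q) (_ , q′)} →
                  ⊙-cong (tracked p) (tracked p′) (tracked q) (tracked q′)
              }
            ; assoc = λ (_ , p) (_ , q) (_ , r) → same-source⇒∼
                (tracked-⊙ (tracked-⊙ (tracked p) (tracked q)) (tracked r))
                (tracked-⊙ (tracked p) (tracked-⊙ (tracked q) (tracked r))) (λ _ → refl)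
            }
          ; identity = (λ (_ , p) → same-source⇒∼ (tracked-⊙ empty-tracked (tracked p)) (tracked p) (λ _ → refl))
                     , (λ (_ , p) → same-source⇒∼ (tracked-⊙ (tracked p) empty-tracked) (tracked p) (λ _ → refl))
          }
        ; inverse = (λ (_ , p) → let t = tracked p in
              same-source⇒∼ (tracked-⊙ (power-tracked t (exponent 24)) t) empty-tracked λ c →
                trans (cong (source t) (power-source t (exponent 24) c)) (source-period t c))
                  , (λ (_ , p) → let t = tracked p in
              same-source⇒∼ (tracked-⊙ t (power-tracked t (exponent 24))) empty-tracked λ c →
                trans (power-source t (exponent 24) (source t c))
                  (trans (fold-comm c (exponent 24)) (source-period t c)))
        ; ⁻¹-cong = λ {(_ , p) (_ , q)} σ∼τ → power-cong (tracked p) (tracked q) σ∼τ (exponent 24)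
        }
      }

  solved⇔tracked : ∀ σ → ConvergentOverSolved σ ⇔ Tracked σ
  solved⇔tracked σ = mk⇔ (convergent-over-solved⇒tracked σ) (λ t → tracked⇒convergent σ t λ _ ())

  universal⇔tracked : ∀ σ → UniversallyConvergent σ ⇔ Tracked σ
  universal⇔tracked σ = mk⇔ (universally-convergent⇒tracked σ) (λ t → tracked⇒convergent σ t λ _ ())

  -- Here `f` is `solved` composed with the source map, and `k ∸ 1` more applications complete a
  -- `k`-th iterate. That iterate fixes every cell, because the source map acts injectively on each
  -- orbit of at most 24 cells.
  undo : ∀ {σ f k} → IsLCM (OrderOfSomePermutation 24) k → Tracked σ → Terminal σ solved f →
         Terminal (power σ (k ∸ 1)) f solved
  undo {k = zero} isLCM t _ = contradiction (lcm-positive isLCM) λ ()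
  undo {σ} {f} {suc k} isLCM t terminal = Equivalence.from (terminal⇔ (power σ k) (power-tracked t k)) λ c →
    begin
      f (source (power-tracked t k) c)     ≡⟨ cong f (power-source t k c) ⟩
      f (fold c (source t) k)              ≡⟨ Equivalence.to (terminal⇔ σ t) terminal _ ⟨
      solved (fold c (source t) (suc k))   ≡⟨ cong solved (period c) ⟩
      solved c                             ∎
    where
    open ≡-Reasoning
    period : ∀ c → fold c (source t) (suc k) ≡ c
    period c with g , eq ← orbit-surjective (self-∈Orbit c) =
      subst (λ d → fold d (source t) (suc k) ≡ d) eq
        (fold-lcm-orbit isLCM (λ _ _ → em) (source-injective t) (orbit c)
          (λ g → orbit-surjective (source-∈Orbit t (orbit-∈Orbit c g))) g)

theorem4p3 : ∀ {ℓ} (em : ExcludedMiddle ℓ) (L : Set ℓ) → Infinite L →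
    let open EdgedCube em L in
    (Σ[ solved⇔uc ∈ (∀ σ → ConvergentOverSolved σ ⇔ UniversallyConvergent σ) ]
    Σ[ G ∈ GroupModulo∼ ConvergentOverSolved ]
    Σ[ UC ∈ GroupModulo∼ UniversallyConvergent ]
    GroupMorphisms.IsGroupIsomorphism
    (Group.rawGroup (GroupModulo∼.group G)) (Group.rawGroup (GroupModulo∼.group UC))
    (λ (σ , p) → σ , Equivalence.to (solved⇔uc σ) p))
    × (∀ (k : ℕ) → IsLCM (OrderOfSomePermutation 24) k →
    ∀ (σ : BasicSequence) (f : Configuration) → Terminal σ solved f → Legal f →
    Σ[ τ ∈ BasicSequence ]
    (length τ ≤ₒ length σ ·ₒ finite (k ∸ 1)) × Terminal τ f solved)
theorem4p3 em L _ =
  (solved⇔uc , G , UC , isomorphism) ,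
  λ k isLCM σ f terminal legal → power σ (k ∸ 1) , power-length σ (k ∸ 1) ,
    undo isLCM (convergent-over-solved⇒tracked σ (f , terminal , legal)) terminal
  where
  open EdgedCube em L
  open Runs em L
  open Sequences em L
  solved⇔uc : ∀ σ → ConvergentOverSolved σ ⇔ UniversallyConvergent σ
  solved⇔uc σ = ⇔-sym (universal⇔tracked σ) ⇔-∘ solved⇔tracked σ
  G : GroupModulo∼ ConvergentOverSolved
  G = groupModulo∼ solved⇔tracked
  UC : GroupModulo∼ UniversallyConvergent
  UC = groupModulo∼ universal⇔tracked
  isomorphism : GroupMorphisms.IsGroupIsomorphism
    (Group.rawGroup (GroupModulo∼.group G)) (Group.rawGroup (GroupModulo∼.group UC))
    (λ (σ , p) → σ , Equivalence.to (solved⇔uc σ) p)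
  -- The map keeps the sequence and changes only the proof of convergence, and both groups share `∼`
  -- and their operations on sequences, so each condition is reflexivity or an identity.
  isomorphism = record
    { isGroupMonomorphism = record
      { isGroupHomomorphism = record
        { isMonoidHomomorphism = record
          { isMagmaHomomorphism = record
            { isRelHomomorphism = record { cong = id }
            ; homo              = λ _ _ f g → ⇔-id _
            }
          ; ε-homo              = λ f g → ⇔-id _
          }
        ; ⁻¹-homo               = λ _ f g → ⇔-id _
        }
      ; injective           = id
      }
    ; surjective          = λ (σ , q) → (σ , Equivalence.from (solved⇔uc σ) q) , id
    }
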